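{- There is a choice of the sample size $\ell=O(\log n)$ such that, for any weighted stream of $n$ updates, the Reduce-By-Sample-Median algorithm (defined in the context) with $k$ counters and sample size $\ell$ can be implemented to run in amortized constant time per stream update with probability at least $1-1/n$ (over the algorithm's random sampling), assuming counters are stored in a hash table supporting insertions, deletions and lookups in amortized $O(1)$ time and enumeration of all counters in $O(k)$ time.
   Context: A weighted stream over the universe $[m]=\{1,\dots,m\}$ is a sequence of updates $(i_1,\Delta_1),\dots,(i_n,\Delta_n)$ with $i_t\in[m]$ and real weights $\Delta_t>0$. The Reduce-By-Sample-Median algorithm with parameters $k\ge 1$ (number of counters) and $\ell\ge 1$ (sample size) maintains a set $T\subseteq[m]$ of at most $k$ items, each $j\in T$ carrying a nonnegative real counter $c(j)$; initially $T=\emptyset$. Update$(i,\Delta)$: if $i\in T$, set $c(i)\gets c(i)+\Delta$; else if $|T|<k$, add $i$ to $T$ with $c(i)=\Delta$; else call DecrementCounters(), and afterwards, if $\Delta\ge c^*$, add $i$ to $T$ with $c(i)=\Delta-c^*$. DecrementCounters(): sample $\ell$ counters uniformly at random from $T$ (fresh randomness in each call) and let $c^*$ be the median of the sampled counter values; for every $j\in T$ set $c(j)\gets c(j)-c^*$, and remove $j$ from $T$ if now $c(j)\le 0$. Estimate$(i)$ returns $c(i)$ if $i\in T$ and $0$ otherwise. -}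

module Defs where

open import Algebra.Structures using (IsAbelianGroup)
open import Data.Bool.Base using (if_then_else_)
open import Data.Fin.Base as Fin using (Fin; toℕ; fromℕ<; inject≤)
open import Data.Fin.Properties as Fin using ()
open import Data.List.Base as List using (List; []; _∷_; _++_; [_]; length; filter; cartesianProductWith; allFin)
open import Data.List.Properties using (length-++; length-map; length-tabulate)
open import Data.List.Relation.Binary.Permutation.Propositional.Properties using (↭-length)
import Data.List.Sort as Sort
open import Data.Integer.Base using (+_)
open import Data.Maybe.Base using (Maybe; just; nothing)
open import Data.Nat.Base using (ℕ; zero; suc; _+_; _*_; _∸_; _^_; _⊔_; _≤_; _<_; s≤s; ⌊_/2⌋; NonZero)
open import Data.Nat.GeneralisedArithmetic using (iterate)
open import Data.Nat.ListAction using (sum)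
open import Data.Nat.Properties as ℕ using (≮⇒≥; m^n≢0; ⌊n/2⌋≤n)
open import Data.Product.Base using (_×_; _,_; proj₁; proj₂; map₁; map₂)
open import Data.Rational.Unnormalised.Base using (ℚᵘ; _/_)
open import Data.Vec.Base as Vec using (Vec; []; _∷_; toList)
open import Data.Vec.Properties as Vec using ()
open import Data.Vec.Relation.Unary.All using (All)
open import Level using (0ℓ)
open import Relation.Binary.Bundles using (DecTotalOrder)
open import Relation.Binary.Definitions using (DecidableEquality)
open import Relation.Binary.Structures using (IsDecTotalOrder)
open import Relation.Binary.PropositionalEquality using (_≡_; _≢_; refl; sym; trans; cong; cong₂; subst)
open import Relation.Nullary.Decidable.Core using (does; yes; no)
open import Relation.Nullary.Decidable using (¬?)
open import Relation.Unary using (Decidable)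

------------------------------------------------------------------------
-- Weights

-- Stands in for the real numbers, of which the algorithm uses only
-- addition, subtraction and comparison.
record OrderedAbelianGroup : Set₁ where
  infixl 6 _⊹_ _⊖_
  infix  4 _≼_
  field
    Carrier         : Set
    _≼_             : Carrier → Carrier → Set
    _⊹_             : Carrier → Carrier → Carrier
    0#              : Carrier
    neg             : Carrier → Carrier
    isAbelianGroup  : IsAbelianGroup _≡_ _⊹_ 0# neg
    isDecTotalOrder : IsDecTotalOrder _≡_ _≼_
    ⊹-monoˡ-≼       : ∀ z {x y} → x ≼ y → x ⊹ z ≼ y ⊹ z

  _⊖_ : Carrier → Carrier → Carrier
  x ⊖ y = x ⊹ neg y

  decTotalOrder : DecTotalOrder 0ℓ 0ℓ 0ℓ
  decTotalOrder = record { isDecTotalOrder = isDecTotalOrder }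

  open IsDecTotalOrder isDecTotalOrder public using () renaming (_≤?_ to _≼?_)

------------------------------------------------------------------------
-- Association lists with distinct keys; `set` keeps the position of an
-- existing key and appends a new one.

module Assoc {K : Set} (_≟_ : DecidableEquality K) {V : Set} where

  find : K → List (K × V) → Maybe V
  find i [] = nothing
  find i ((j , c) ∷ T) = if does (i ≟ j) then just c else find i T

  set : K → V → List (K × V) → List (K × V)
  set i v [] = [ (i , v) ]
  set i v ((j , c) ∷ T) = if does (i ≟ j) then (j , v) ∷ T else (j , c) ∷ set i v T

  remove : K → List (K × V) → List (K × V)
  remove i = filter (λ e → ¬? (i ≟ proj₁ e))

------------------------------------------------------------------------
-- Finite uniform probability

-- All vectors of length n with entries from a list.
vectors : {A : Set} → List A → ∀ n → List (Vec A n)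
vectors xs zero    = [ [] ]
vectors xs (suc n) = cartesianProductWith _∷_ xs (vectors xs n)

private
  length-product : {A B C : Set} (f : A → B → C) (xs : List A) (ys : List B) →
                   length (cartesianProductWith f xs ys) ≡ length xs * length ys
  length-product f []       ys = refl
  length-product f (x ∷ xs) ys =
    trans (length-++ (List.map (f x) ys))
          (cong₂ _+_ (length-map (f x) ys) (length-product f xs ys))

length-vectors : {A : Set} (xs : List A) → ∀ n → length (vectors xs n) ≡ length xs ^ n
length-vectors xs zero    = refl
length-vectors xs (suc n) =
  trans (length-product _∷_ xs (vectors xs n))
        (cong (length xs *_) (length-vectors xs n))

-- Row t holds the ℓ indices drawn (independently, with replacement) by
-- the call of DecrementCounters made during update t, if there is one.
-- At such a call |T| = k, so an element of Fin k designates a counter.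
Tape : (k ℓ n : ℕ) → Set
Tape k ℓ n = Vec (Vec (Fin k) ℓ) n

tapes : ∀ k ℓ n → List (Tape k ℓ n)
tapes k ℓ n = vectors (vectors (allFin k) ℓ) n

length-tapes : ∀ k ℓ n → length (tapes k ℓ n) ≡ (k ^ ℓ) ^ n
length-tapes k ℓ n =
  trans (length-vectors (vectors (allFin k) ℓ) n)
        (cong (_^ n) (trans (length-vectors (allFin k) ℓ) (cong (_^ ℓ) (length-tabulate {n = k} (λ i → i)))))

tapes-nonZero : ∀ k ℓ n .{{_ : NonZero k}} → NonZero (length (tapes k ℓ n))
tapes-nonZero k ℓ n =
  subst NonZero (sym (length-tapes k ℓ n)) (m^n≢0 (k ^ ℓ) n {{m^n≢0 k ℓ}})

-- The probability of P under the uniform distribution on tapes.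
Pr : ∀ {k ℓ n} .{{_ : NonZero k}} {P : Tape k ℓ n → Set} → Decidable P → ℚᵘ
Pr {k} {ℓ} {n} P? = (+ length (filter P? Ω) / length Ω) {{tapes-nonZero k ℓ n}}
  where
  Ω : List (Tape k ℓ n)
  Ω = tapes k ℓ n

------------------------------------------------------------------------
-- Weighted streams and Reduce-By-Sample-Median

module _ (G : OrderedAbelianGroup) where
  open OrderedAbelianGroup G renaming (Carrier to V)

  Stream : (m n : ℕ) → Set
  Stream m n = Vec (Fin m × V) n

  Positive : V → Set
  Positive Δ = 0# ≼ Δ × 0# ≢ Δ

  Weighted : ∀ {m n} → Stream m n → Set
  Weighted = All (λ u → Positive (proj₂ u))

  -- The ⌈ℓ/2⌉-th smallest of ℓ values.
  median : ∀ {ℓ} .{{_ : NonZero ℓ}} → Vec V ℓ → V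
  median {suc ℓ} xs = List.lookup (sort (toList xs)) (fromℕ< {⌊ ℓ /2⌋} within)
    where
    open Sort decTotalOrder using (sort; sort-↭)
    within : ⌊ ℓ /2⌋ < length (sort (toList xs))
    within = subst (⌊ ℓ /2⌋ <_)
      (sym (trans (↭-length (sort-↭ (toList xs))) (Vec.length-toList xs)))
      (s≤s (⌊n/2⌋≤n ℓ))

  Counters : ℕ → Set
  Counters m = List (Fin m × V)

  module _ {m : ℕ} where
    open Assoc (Fin._≟_ {m}) {V}

    decrement : V → Counters m → Counters m
    decrement c* T = filter (λ e → ¬? (proj₂ e ≼? 0#)) (List.map (map₂ (_⊖ c*)) T)

    sampleMedian : ∀ {k ℓ} .{{_ : NonZero ℓ}} (T : Counters m) → k ≤ length T → Vec (Fin k) ℓ → V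
    sampleMedian T k≤|T| s = median (Vec.map (λ r → proj₂ (List.lookup T (inject≤ r k≤|T|))) s)

    update : ∀ {k ℓ} .{{_ : NonZero ℓ}} → Counters m → (Fin m × V) × Vec (Fin k) ℓ → Counters m
    update {k} T ((i , Δ) , s) with find i T
    ... | just c = set i (c ⊹ Δ) T
    ... | nothing with length T ℕ.<? k
    ...   | yes _    = set i Δ T
    ...   | no |T|≮k =
      let c* = sampleMedian T (≮⇒≥ |T|≮k) s
          T′ = decrement c* T
      in if does (c* ≼? Δ) then set i (Δ ⊖ c*) T′ else T′

    reduceBySampleMedian : ∀ {k ℓ n} .{{_ : NonZero ℓ}} → Stream m n → Tape k ℓ n → Counters m
    reduceBySampleMedian xs ω = List.foldl update [] (toList (Vec.zip xs ω))

------------------------------------------------------------------------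
-- A unit-cost random access machine with a hash table.  It has one memory
-- of words (natural numbers) and one of weights, both addressed by words.

data Word : Set where
  lit : ℕ → Word
  mem : Word → Word
  _⊕_ : Word → Word → Word
  _⊝_ : Word → Word → Word

data Weight : Set where
  mem : Word → Weight
  _⊕_ : Weight → Weight → Weight
  _⊝_ : Weight → Weight → Weight

infixl 6 _⊕_ _⊝_
infix  5 _≔_ _≔ʷ_
infixr 4 _⨾_

data Program : Set where
  skip       : Program
  _≔_        : (address : Word) → Word → Program
  _≔ʷ_       : (address : Word) → Weight → Program
  _⨾_        : Program → Program → Program
  if_≤_then_else_  : Word → Word → Program → Program → Program
  if_≤ʷ_then_else_ : Weight → Weight → Program → Program → Program
  -- The number of iterations is evaluated once, on entry.
  repeat_times_ : Word → Program → Program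
  -- Store the next random index.
  sample     : (address : Word) → Program
  -- Store 1 and the value if the key is present, and store 0 otherwise.
  lookup     : (key flagAddress valueAddress : Word) → Program
  insert     : (key : Word) → Weight → Program
  delete     : (key : Word) → Program
  -- Store keys and values consecutively from the given addresses.
  enumerate  : (keyAddress valueAddress : Word) → Program

wordCost : Word → ℕ
wordCost (lit _) = 1
wordCost (mem e) = suc (wordCost e)
wordCost (e ⊕ f) = suc (wordCost e + wordCost f)
wordCost (e ⊝ f) = suc (wordCost e + wordCost f)

weightCost : Weight → ℕ
weightCost (mem e) = suc (wordCost e)
weightCost (v ⊕ w) = suc (weightCost v + weightCost w)
weightCost (v ⊝ w) = suc (weightCost v + weightCost w)

data HashOp (V : Set) : Set where
  lookup    : (key : ℕ) → HashOp V
  insert    : (key : ℕ) → V → HashOp V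
  delete    : (key : ℕ) → HashOp V
  enumerate : (size : ℕ) → HashOp V

-- The table has room for k entries; enumerating a larger one is charged
-- its size.
charge : {V : Set} → ℕ → HashOp V → ℕ
charge k (lookup _)    = 1
charge k (insert _ _)  = 1
charge k (delete _)    = 1
charge k (enumerate s) = k ⊔ s

-- `cost ops` is the total running time of the hash table on the sequence
-- of operations ops, starting from the empty table.  Individual operations
-- may be expensive: only the total is bounded.
Amortized : {V : Set} (a k : ℕ) (cost : List (HashOp V) → ℕ) → Set
Amortized a k cost = ∀ ops → cost ops ≤ a * sum (List.map (charge k) ops)

module Machine (G : OrderedAbelianGroup) where
  open OrderedAbelianGroup G renaming (Carrier to V)
  open Assoc ℕ._≟_ {V}

  record State : Set where
    field
      words   : ℕ → ℕ
      weights : ℕ → V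
      table   : List (ℕ × V)
      random  : List ℕ
      steps   : ℕ
      hashOps : List (HashOp V)

  open State

  initial : State
  initial = record
    { words = λ _ → 0 ; weights = λ _ → 0# ; table = [] ; random = [] ; steps = 0 ; hashOps = [] }

  _[_↦_] : {A : Set} → (ℕ → A) → ℕ → A → ℕ → A
  (f [ x ↦ v ]) y = if does (y ℕ.≟ x) then v else f y

  -- Write a list to consecutive addresses.
  _[_↦*_] : {A : Set} → (ℕ → A) → ℕ → List A → ℕ → A
  f [ x ↦* [] ]     = f
  f [ x ↦* v ∷ vs ] = (f [ suc x ↦* vs ]) [ x ↦ v ]

  word : State → Word → ℕ
  word σ (lit c) = c
  word σ (mem e) = words σ (word σ e)
  word σ (e ⊕ f) = word σ e + word σ f
  word σ (e ⊝ f) = word σ e ∸ word σ f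

  weight : State → Weight → V
  weight σ (mem e) = weights σ (word σ e)
  weight σ (v ⊕ w) = weight σ v ⊹ weight σ w
  weight σ (v ⊝ w) = weight σ v ⊖ weight σ w

  tick : ℕ → State → State
  tick t σ = record σ { steps = t + steps σ }

  setWord : ℕ → ℕ → State → State
  setWord x v σ = record σ { words = words σ [ x ↦ v ] }

  setWeight : ℕ → V → State → State
  setWeight x v σ = record σ { weights = weights σ [ x ↦ v ] }

  setFound : ℕ → ℕ → Maybe V → State → State
  setFound x y (just c) σ = setWord x 1 (setWeight y c σ)
  setFound x y nothing  σ = setWord x 0 σ

  log : HashOp V → State → State
  log op σ = record σ { hashOps = hashOps σ ++ [ op ] }

  exec : Program → State → State
  exec skip σ = tick 1 σ
  exec (e ≔ f) σ = tick (1 + wordCost e + wordCost f) (setWord (word σ e) (word σ f) σ)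
  exec (e ≔ʷ v) σ = tick (1 + wordCost e + weightCost v) (setWeight (word σ e) (weight σ v) σ)
  exec (p ⨾ q) σ = exec q (exec p σ)
  exec (if e ≤ f then p else q) σ =
    let σ′ = tick (1 + wordCost e + wordCost f) σ in
    if does (word σ e ℕ.≤? word σ f) then exec p σ′ else exec q σ′
  exec (if v ≤ʷ w then p else q) σ =
    let σ′ = tick (1 + weightCost v + weightCost w) σ in
    if does (weight σ v ≼? weight σ w) then exec p σ′ else exec q σ′
  exec (repeat e times p) σ =
    iterate (λ τ → exec p (tick 1 τ)) (tick (1 + wordCost e) σ) (word σ e)
  exec (sample e) σ with random σ
  ... | []     = tick (1 + wordCost e) (setWord (word σ e) 0 σ)
  ... | r ∷ rs = tick (1 + wordCost e) (setWord (word σ e) r (record σ { random = rs }))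
  exec (lookup e f g) σ = log (lookup (word σ e)) (tick (1 + wordCost e + wordCost f + wordCost g)
    (setFound (word σ f) (word σ g) (find (word σ e) (table σ)) σ))
  exec (insert e v) σ = log (insert (word σ e) (weight σ v)) (tick (1 + wordCost e + weightCost v)
    (record σ { table = set (word σ e) (weight σ v) (table σ) }))
  exec (delete e) σ = log (delete (word σ e)) (tick (1 + wordCost e)
    (record σ { table = remove (word σ e) (table σ) }))
  exec (enumerate e f) σ = log (enumerate (length (table σ))) (tick (1 + wordCost e + wordCost f)
    (record σ
      { words   = words σ [ word σ e ↦* List.map proj₁ (table σ) ]
      ; weights = weights σ [ word σ f ↦* List.map proj₂ (table σ) ]
      }))

  -- Before each update the inputs k, ℓ, i are placed in words 0, 1, 2 and
  -- Δ in weight 0, and ℓ fresh indices are made available to `sample`.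
  -- All other memory persists between updates.
  module _ {m k ℓ : ℕ} (p : Program) where

    receive : (Fin m × V) × Vec (Fin k) ℓ → State → State
    receive ((i , Δ) , s) σ = record σ
      { words   = ((words σ [ 0 ↦ k ]) [ 1 ↦ ℓ ]) [ 2 ↦ toℕ i ]
      ; weights = weights σ [ 0 ↦ Δ ]
      ; random  = List.map toℕ (toList s)
      }

    run : ∀ {n} → Stream G m n → Tape k ℓ n → State
    run xs ω = List.foldl (λ σ u → exec p (receive u σ)) initial (toList (Vec.zip xs ω))

  -- The time taken to process a whole stream.
  time : ∀ {m k ℓ n} → Program → (List (HashOp V) → ℕ) → Stream G m n → Tape k ℓ n → ℕ
  time p cost xs ω = let σ = run p xs ω in steps σ + cost (hashOps σ)

-- For every stream and every outcome of the sampling, the hash table holds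
-- exactly the counters of the algorithm.
Implements : Program → Set₁
Implements p =
  (G : OrderedAbelianGroup) (m k ℓ n : ℕ) .{{_ : NonZero k}} .{{_ : NonZero ℓ}}
  (xs : Stream G m n) → Weighted G xs → (ω : Tape k ℓ n) →
  Machine.State.table (Machine.run G p xs ω) ≡ List.map (map₁ toℕ) (reduceBySampleMedian G xs ω)

{-# OPTIONS --safe #-}
module Submission where

-- Call a counter low if fewer than k/64 counters are at most it; at most
-- k/64 counters are low.  If a call of DecrementCounters removes fewer than
-- k/64 counters then c* is low, hence so is at least half of the sample.
-- Weight a sample by 64 per low entry: the average weight is at most 2^ℓ,
-- whereas a failing call has weight at least 8^ℓ.  Giving weight 2^ℓ to the
-- updates without a call, the product over all updates has average at most
-- 2^(ℓn).  Since every update adds at most one counter, only O(n/k) calls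
-- can remove k/64 counters, so each further call multiplies the product by
-- 8^ℓ instead of 2^ℓ, and by Markov's inequality more than O(n/k + (log n)/ℓ)
-- calls have probability at most 1/n.  A call takes time O(k + ℓ²), which
-- yields O(n) in total for ℓ = 1 if k log n ≤ n, and for ℓ = 1 + log n
-- otherwise.  The base 8 is the parameter b, and 64 is b².

open import Defs renaming (if_≤_then_else_ to test_≤_then_else_; if_≤ʷ_then_else_ to test_≤ʷ_then_else_)
open import Algebra.Structures using (IsAbelianGroup)
open import Data.Bool.Base using (Bool; T; true; false; if_then_else_)
open import Data.Empty using (⊥)
open import Data.Fin.Base as Fin using (Fin; toℕ; fromℕ<; inject≤)
import Data.Fin.Properties as Fin
import Data.Integer.Base as ℤ
import Data.Integer.Properties as ℤ
open import Data.List.Base as List using (List; []; _∷_; _++_; [_]; length; filter; cartesianProductWith; allFin; tabulate)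
open import Data.List.Membership.Propositional using (_∈_)
open import Data.List.Membership.Propositional.Properties using (∈-map⁺; ∈-map⁻; ∈-lookup; ∈-filter⁺; ∈-filter⁻)
open import Data.List.Properties using (map-++; map-cong; map-tabulate; length-map; length-++; length-tabulate; ++-assoc; filter-all; filter-some; filter-++; filter-reject)
open import Data.List.Relation.Binary.Permutation.Propositional using (_↭_)
open import Data.List.Relation.Binary.Permutation.Propositional.Properties using (↭-length; filter-↭; ∈-resp-↭)
open import Data.List.Relation.Unary.All as All using (All; []; _∷_)
import Data.List.Relation.Unary.All.Properties as All
open import Data.List.Relation.Unary.AllPairs using (AllPairs; []; _∷_)
import Data.List.Relation.Unary.AllPairs.Properties as AllPairs
open import Data.List.Relation.Unary.Any as Any using (here; there)
open import Data.List.Relation.Unary.Sorted.TotalOrder.Properties using (Sorted⇒AllPairs)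
import Data.List.Sort as Sort
open import Data.Maybe.Base using (Maybe; just; nothing; maybe; is-just)
open import Data.Nat.Base hiding (_/_)
import Data.Nat.DivMod as DivMod
open import Data.Nat.DivMod using (m/n*n≤m; m≡m%n+[m/n]*n; m%n<n)
open import Data.Nat.GeneralisedArithmetic using (iterate)
open import Data.Nat.ListAction using (sum)
open import Data.Nat.ListAction.Properties using (sum-++)
open import Data.Nat.Logarithm
open import Data.Nat.Properties
open import Data.Nat.Tactic.RingSolver using (solve-∀)
open import Data.Product.Base using (∃; ∃₂; _×_; _,_; proj₁; proj₂; map₁; map₂)
open import Data.Sum.Base using (_⊎_; inj₁; inj₂)
open import Data.Unit.Base using (⊤; tt)
open import Data.Vec.Base as Vec using (Vec; []; _∷_; toList)
import Data.Vec.Properties as Vec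
open import Function.Base using (_∘_; id)
open import Relation.Binary.Bundles using (DecTotalOrder)
open import Relation.Binary.Definitions using (DecidableEquality)
open import Relation.Binary.PropositionalEquality hiding ([_])
open import Relation.Binary.Structures using (IsDecTotalOrder)
open import Relation.Nullary.Decidable using (does; yes; no; ¬?; dec-true; dec-false)
open import Relation.Nullary.Negation using (¬_; contradiction)
open import Relation.Unary using (Decidable)

-- The tables from which different calls sample depend on all earlier samples, so failures of
-- different calls are not independent events. The average weight of one sample, however, is bounded
-- uniformly in the table, and that is all an induction over the updates needs: it is a
-- supermartingale argument in counting form. The constants fit together as follows. Giving weight
-- b² to a fraction of at most 1/b² of the counters adds at most 1 to the average weight of an
-- entry, which becomes at most 2; a sample then averages at most q = 2^ℓ. If half of the entries
-- are low, the weight is at least b^ℓ, and b = 8 makes this q³, a gain of q² over the average. A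
-- call that removes many counters may have weight as small as 1, and a factor q³ is granted in
-- compensation. This is the origin of the exponents 1 + 2d and 3g in `progress`. The machine finds
-- the median by testing every sample against the whole sample. This costs ℓ² and is the reason why
-- ℓ cannot simply be log n for every k.

private
  variable
    A B : Set

-- Sums over finite lists

^-distribʳ-* : ∀ n x y → (x * y) ^ n ≡ x ^ n * y ^ n
^-distribʳ-* zero    x y = refl
^-distribʳ-* (suc n) x y = trans (cong ((x * y) *_) (^-distribʳ-* n x y)) (eq x y (x ^ n) (y ^ n))
  where
  eq : ∀ a b c d → (a * b) * (c * d) ≡ (a * c) * (b * d)
  eq = solve-∀

∑ : (A → ℕ) → List A → ℕ
∑ f xs = sum (List.map f xs)

∑-++ : (f : A → ℕ) (xs ys : List A) → ∑ f (xs ++ ys) ≡ ∑ f xs + ∑ f ys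
∑-++ f xs ys = trans (cong sum (map-++ f xs ys)) (sum-++ (List.map f xs) (List.map f ys))

∑-mono : {f g : A → ℕ} → (∀ x → f x ≤ g x) → ∀ xs → ∑ f xs ≤ ∑ g xs
∑-mono f≤g []       = z≤n
∑-mono f≤g (x ∷ xs) = +-mono-≤ (f≤g x) (∑-mono f≤g xs)

∑-*ʳ : (f : A → ℕ) (c : ℕ) (xs : List A) → ∑ (λ x → f x * c) xs ≡ ∑ f xs * c
∑-*ʳ f c []       = refl
∑-*ʳ f c (x ∷ xs) = trans (cong ((f x * c) +_) (∑-*ʳ f c xs)) (sym (*-distribʳ-+ c (f x) (∑ f xs)))

∑-*ˡ : (c : ℕ) (f : A → ℕ) (xs : List A) → ∑ (λ x → c * f x) xs ≡ c * ∑ f xs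
∑-*ˡ c f []       = sym (*-zeroʳ c)
∑-*ˡ c f (x ∷ xs) = trans (cong ((c * f x) +_) (∑-*ˡ c f xs)) (sym (*-distribˡ-+ c (f x) (∑ f xs)))

∑-const : (c : ℕ) (xs : List A) → ∑ (λ _ → c) xs ≡ length xs * c
∑-const c []       = refl
∑-const c (x ∷ xs) = cong (λ z → c + z) (∑-const c xs)

∑-map : (f : B → ℕ) (g : A → B) (xs : List A) → ∑ f (List.map g xs) ≡ ∑ (f ∘ g) xs
∑-map f g []       = refl
∑-map f g (x ∷ xs) = cong (f (g x) +_) (∑-map f g xs)

-- Peels off the first entry so that the summand over the rest may depend on it; for tapes this is
-- conditioning on the first sample.
∑-vectors : ∀ {n} (f : Vec A (suc n) → ℕ) (xs : List A) →
            ∑ f (vectors xs (suc n)) ≡ ∑ (λ x → ∑ (λ v → f (x ∷ v)) (vectors xs n)) xs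
∑-vectors {A = A} {n = n} f xs = go xs
  where
  ys : List (Vec A n)
  ys = vectors xs n
  go : ∀ zs → ∑ f (cartesianProductWith _∷_ zs ys) ≡ ∑ (λ x → ∑ (λ v → f (x ∷ v)) ys) zs
  go []       = refl
  go (z ∷ zs) = trans (∑-++ f (List.map (z ∷_) ys) (cartesianProductWith _∷_ zs ys))
                      (cong₂ _+_ (∑-map f (z ∷_) ys) (go zs))

∏ : (A → ℕ) → ∀ {n} → Vec A n → ℕ
∏ f []       = 1
∏ f (x ∷ xs) = f x * ∏ f xs

-- The entries are independent, so averages of products factorise.
∑-∏ : (f : A → ℕ) (xs : List A) → ∀ n → ∑ (∏ f) (vectors xs n) ≡ ∑ f xs ^ n
∑-∏ f xs zero    = refl
∑-∏ f xs (suc n) = begin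
  ∑ (∏ f) (vectors xs (suc n))                  ≡⟨ ∑-vectors (∏ f) xs ⟩
  ∑ (λ x → ∑ (λ v → f x * ∏ f v) (vectors xs n)) xs
    ≡⟨ cong sum (map-cong′ xs) ⟩
  ∑ (λ x → f x * ∑ f xs ^ n) xs                 ≡⟨ ∑-*ʳ f (∑ f xs ^ n) xs ⟩
  ∑ f xs * ∑ f xs ^ n                           ∎
  where
  open ≡-Reasoning
  map-cong′ = map-cong {f = λ x → ∑ (λ v → f x * ∏ f v) (vectors xs n)}
    (λ x → trans (∑-*ˡ (f x) (∏ f) (vectors xs n)) (cong (f x *_) (∑-∏ f xs n)))

-- Markov's inequality multiplied by the number of outcomes, which avoids division.
markov : {P : A → Set} (P? : Decidable P) (f : A → ℕ) (c : ℕ) → (∀ x → P x → c ≤ f x) →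
         ∀ xs → length (filter P? xs) * c ≤ ∑ f xs
markov P? f c P⇒≤ []       = z≤n
markov P? f c P⇒≤ (x ∷ xs) with P? x
... | yes p = +-mono-≤ (P⇒≤ x p) (markov P? f c P⇒≤ xs)
... | no  _ = ≤-trans (markov P? f c P⇒≤ xs) (m≤n+m _ (f x))

length-filter-¬ : {P : A → Set} (P? : Decidable P) (xs : List A) →
                  length (filter P? xs) + length (filter (¬? ∘ P?) xs) ≡ length xs
length-filter-¬ P? []       = refl
length-filter-¬ P? (x ∷ xs) with P? x
... | yes _ = cong suc (length-filter-¬ P? xs)
... | no  _ = trans (+-suc _ _) (cong suc (length-filter-¬ P? xs))

-- Counting, association lists and medians

count : {P : A → Set} → Decidable P → List A → ℕ
count P? xs = length (filter P? xs)

count-∷ : {P : A → Set} (P? : Decidable P) (x : A) (xs : List A) →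
          count P? (x ∷ xs) ≡ (if does (P? x) then 1 else 0) + count P? xs
count-∷ P? x xs with does (P? x)
... | true  = refl
... | false = refl

count-mono : {P Q : A → Set} (P? : Decidable P) (Q? : Decidable Q) {xs : List A} →
             All (λ x → P x → Q x) xs → count P? xs ≤ count Q? xs
count-mono P? Q? []            = z≤n
count-mono P? Q? {x ∷ xs} (f ∷ fs) with P? x | Q? x
... | yes _ | yes _ = s≤s (count-mono P? Q? fs)
... | yes p | no ¬q = contradiction (f p) ¬q
... | no  _ | yes _ = m≤n⇒m≤1+n (count-mono P? Q? fs)
... | no  _ | no  _ = count-mono P? Q? fs

count-disjoint : {P Q : A → Set} (P? : Decidable P) (Q? : Decidable Q) →
                 (∀ x → P x → ¬ Q x) → ∀ xs → count P? xs + count Q? xs ≤ length xs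
count-disjoint P? Q? dis []       = z≤n
count-disjoint P? Q? dis (x ∷ xs) with P? x | Q? x
... | yes p | yes q = contradiction q (dis x p)
... | yes _ | no  _ = s≤s (count-disjoint P? Q? dis xs)
... | no  _ | yes _ = ≤-trans (≤-reflexive (+-suc _ _)) (s≤s (count-disjoint P? Q? dis xs))
... | no  _ | no  _ = m≤n⇒m≤1+n (count-disjoint P? Q? dis xs)

count-map : {P : B → Set} (P? : Decidable P) (f : A → B) (xs : List A) →
            count P? (List.map f xs) ≡ count (P? ∘ f) xs
count-map P? f []       = refl
count-map P? f (x ∷ xs) with P? (f x)
... | yes _ = cong suc (count-map P? f xs)
... | no  _ = count-map P? f xs

module Penalty {P : A → Set} (P? : Decidable P) (c : ℕ) where

  penalty : A → ℕ
  penalty x = if does (P? x) then c else 1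

  ∑-penalty : ∀ xs → ∑ penalty xs ≤ length xs + c * count P? xs
  ∑-penalty []       = z≤n
  ∑-penalty (x ∷ xs) with P? x
  ... | yes _ = ≤-trans (+-monoʳ-≤ c (∑-penalty xs))
    (≤-trans (n≤1+n _) (≤-reflexive (eq c (length xs) (count P? xs))))
    where
    eq : ∀ c a b → suc (c + (a + c * b)) ≡ suc a + c * suc b
    eq = solve-∀
  ... | no  _ = s≤s (∑-penalty xs)

  module _ .{{_ : NonZero c}} where

    -- Entries outside `Q` still contribute a factor of at least 1. `Q` may be smaller than `P`: it
    -- is instantiated with the samples at most c*, and with the empty predicate.
    ^count≤∏ : ∀ {ℓ} {Q : A → Set} (Q? : Decidable Q) → (∀ x → Q x → P x) → (xs : Vec A ℓ) →
               c ^ count Q? (toList xs) ≤ ∏ penalty xs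
    ^count≤∏ Q? Q⇒P []       = ≤-refl
    ^count≤∏ Q? Q⇒P (x ∷ xs) with Q? x | P? x
    ... | yes _ | yes _ = *-monoʳ-≤ c (^count≤∏ Q? Q⇒P xs)
    ... | yes q | no ¬p = contradiction (Q⇒P x q) ¬p
    ... | no  _ | yes _ = ≤-trans (^count≤∏ Q? Q⇒P xs) (m≤n*m _ c)
    ... | no  _ | no  _ = ≤-trans (^count≤∏ Q? Q⇒P xs) (m≤m+n _ _)

module AssocProperties {K : Set} (_≟_ : DecidableEquality K) {V : Set} where
  open Assoc _≟_ {V}

  length-set : ∀ i v T → length (set i v T) ≤ suc (length T)
  length-set i v []            = ≤-refl
  length-set i v ((j , c) ∷ T) with does (i ≟ j)
  ... | true  = n≤1+n _
  ... | false = s≤s (length-set i v T)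

  length-set-found : ∀ i v {c} T → find i T ≡ just c → length (set i v T) ≡ length T
  length-set-found i v ((j , c) ∷ T) eq with does (i ≟ j)
  ... | true  = refl
  ... | false = cong suc (length-set-found i v T eq)

  length-set-new : ∀ i v T → find i T ≡ nothing → length (set i v T) ≡ suc (length T)
  length-set-new i v []            eq = refl
  length-set-new i v ((j , c) ∷ T) eq with does (i ≟ j)
  ... | false = cong suc (length-set-new i v T eq)

  find-filter-map : ∀ {P : K × V → Set} (P? : Decidable P) (f : V → V) i T →
                    find i T ≡ nothing → find i (filter P? (List.map (map₂ f) T)) ≡ nothing
  find-filter-map P? f i []            _  = refl
  find-filter-map P? f i ((j , v) ∷ T) eq with does (P? (j , f v)) | does (i ≟ j) in i≟j
  ... | false | false = find-filter-map P? f i T eq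
  ... | true  | false = trans (cong (λ b → if b then just (f v) else find i (filter P? (List.map (map₂ f) T))) i≟j) (find-filter-map P? f i T eq)

  Fresh : K → List (K × V) → Set
  Fresh i = All (λ e → i ≢ proj₁ e)

  Distinct : List (K × V) → Set
  Distinct = AllPairs (λ e f → proj₁ e ≢ proj₁ f)

  fresh-set : ∀ {j} i v T → j ≢ i → Fresh j T → Fresh j (set i v T)
  fresh-set i v []            j≢i []        = j≢i ∷ []
  fresh-set i v ((l , c) ∷ T) j≢i (p ∷ ps) with does (i ≟ l)
  ... | true  = p ∷ ps
  ... | false = p ∷ fresh-set i v T j≢i ps

  distinct-set : ∀ i v T → Distinct T → Distinct (set i v T)
  distinct-set i v []            []       = [] ∷ []
  distinct-set i v ((j , c) ∷ T) (p ∷ ps) with i ≟ j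
  ... | yes _  = p ∷ ps
  ... | no i≢j = fresh-set i v T (λ j≡i → i≢j (sym j≡i)) p ∷ distinct-set i v T ps

  -- Together with `remove-middle` this describes one round of the decrement loop, which works on
  -- the table at the border between a processed prefix and the rest. `set` stops at the first
  -- match, whereas `remove` filters everything and so needs freshness on both sides.
  set-middle : ∀ {i u} v pre post → Fresh i pre → set i v (pre ++ (i , u) ∷ post) ≡ pre ++ (i , v) ∷ post
  set-middle {i} v []              post []       with i ≟ i
  ... | yes _  = refl
  ... | no i≢i = contradiction refl i≢i
  set-middle {i} v ((j , c) ∷ pre) post (p ∷ ps) with i ≟ j
  ... | yes i≡j = contradiction i≡j p
  ... | no  _   = cong ((j , c) ∷_) (set-middle v pre post ps)

  remove-middle : ∀ {i u} pre post → Fresh i pre → Fresh i post → remove i (pre ++ (i , u) ∷ post) ≡ pre ++ post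
  remove-middle {i} {u} pre post ps qs = begin
    remove i (pre ++ (i , u) ∷ post)       ≡⟨ filter-++ other? pre ((i , u) ∷ post) ⟩
    remove i pre ++ remove i ((i , u) ∷ post) ≡⟨ cong₂ _++_ (filter-all other? ps)
      (trans (filter-reject other? (λ i≢i → i≢i refl)) (filter-all other? qs)) ⟩
    pre ++ post ∎
    where
    open ≡-Reasoning
    other? : Decidable (λ (e : K × V) → ¬ i ≡ proj₁ e)
    other? e = ¬? (i ≟ proj₁ e)

-- Order statistics and medians in an ordered abelian group

module Order (G : OrderedAbelianGroup) where
  open OrderedAbelianGroup G renaming (Carrier to V)
  open IsAbelianGroup isAbelianGroup using () renaming (inverseʳ to ⊖-self) public
  open IsDecTotalOrder isDecTotalOrder public using ()
    renaming (refl to ≼-refl; trans to ≼-trans; total to ≼-total; antisym to ≼-antisym)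

  ≼⇒⊖≼0 : ∀ {x y} → x ≼ y → x ⊖ y ≼ 0#
  ≼⇒⊖≼0 {x} {y} x≼y = subst (x ⊖ y ≼_) (⊖-self y) (⊹-monoˡ-≼ (neg y) x≼y)

  #≼ : V → List V → ℕ
  #≼ x = count (_≼? x)

  #≽ : V → List V → ℕ
  #≽ x = count (x ≼?_)

  #≼-mono : ∀ {x y} → x ≼ y → ∀ zs → #≼ x zs ≤ #≼ y zs
  #≼-mono x≼y zs = count-mono (_≼? _) (_≼? _) (All.universal (λ _ z≼x → ≼-trans z≼x x≼y) zs)

  maximum : ∀ ys → ys ≡ [] ⊎ (∃ λ z → z ∈ ys × All (_≼ z) ys)
  maximum []       = inj₁ refl
  maximum (y ∷ ys) with maximum ys
  ... | inj₁ refl = inj₂ (y , here refl , ≼-refl ∷ [])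
  ... | inj₂ (z , z∈ys , ys≼z) with ≼-total y z
  ...   | inj₁ y≼z = inj₂ (z , there z∈ys , y≼z ∷ ys≼z)
  ...   | inj₂ z≼y = inj₂ (y , here refl , ≼-refl ∷ All.map (λ x≼z → ≼-trans x≼z z≼y) ys≼z)

  -- A characterisation by counting alone, which a program can test without sorting. The asymmetry
  -- matters for even length: the extra 1 in `upper` rejects the larger of two distinct middle
  -- values.
  record IsMedian (ys : List V) (x : V) : Set where
    field
      member : x ∈ ys
      lower  : length ys ≤ #≼ x ys + #≼ x ys
      upper  : suc (length ys) ≤ #≽ x ys + #≽ x ys

  private
    -- Otherwise no entry is both at most `x` and at least `y`, although the two counts together
    -- exceed the length.
    not-below : ∀ {ys x y} → length ys ≤ #≼ x ys + #≼ x ys → suc (length ys) ≤ #≽ y ys + #≽ y ys → y ≼ x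
    not-below {ys} {x} {y} lo up with y ≼? x
    ... | yes y≼x = y≼x
    ... | no  y⋠x = contradiction
      (≤-trans (+-mono-≤ up lo) (≤-trans (≤-reflexive (eq (#≽ y ys) (#≼ x ys))) (+-mono-≤ dis dis)))
      (<-irrefl refl)
      where
      dis : #≼ x ys + #≽ y ys ≤ length ys
      dis = count-disjoint (_≼? x) (y ≼?_) (λ z z≼x y≼z → y⋠x (≼-trans y≼z z≼x)) ys
      eq : ∀ a b → (a + a) + (b + b) ≡ (b + a) + (b + a)
      eq = solve-∀

  median-unique : ∀ {ys x y} → IsMedian ys x →
                  length ys ≤ #≼ y ys + #≼ y ys → suc (length ys) ≤ #≽ y ys + #≽ y ys → y ≡ x
  median-unique {ys} med lo up = ≼-antisym (not-below {ys} lower up) (not-below {ys} lo upper)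
    where open IsMedian med

  #≼-lookup : ∀ {zs} → AllPairs _≼_ zs → (i : Fin (length zs)) → suc (toℕ i) ≤ #≼ (List.lookup zs i) zs
  #≼-lookup {z ∷ zs} (z≼zs ∷ _) Fin.zero with z ≼? z
  ... | yes _   = s≤s z≤n
  ... | no  z⋠z = contradiction ≼-refl z⋠z
  #≼-lookup {z ∷ zs} (z≼zs ∷ sorted) (Fin.suc i) with z ≼? List.lookup zs i
  ... | yes _ = s≤s (#≼-lookup sorted i)
  ... | no  ¬≼ = contradiction (All.lookup z≼zs (∈-lookup i)) ¬≼

  #≽-lookup : ∀ {zs} → AllPairs _≼_ zs → (i : Fin (length zs)) → length zs ≤ toℕ i + #≽ (List.lookup zs i) zs
  #≽-lookup {z ∷ zs} (z≼zs ∷ _) Fin.zero =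
    ≤-reflexive (cong length (sym (filter-all (z ≼?_) (≼-refl ∷ z≼zs))))
  #≽-lookup {z ∷ zs} (z≼zs ∷ sorted) (Fin.suc i) = s≤s (≤-trans (#≽-lookup sorted i)
    (+-monoʳ-≤ (toℕ i) step))
    where
    step : #≽ (List.lookup zs i) zs ≤ #≽ (List.lookup zs i) (z ∷ zs)
    step with does (List.lookup zs i ≼? z)
    ... | true  = n≤1+n _
    ... | false = ≤-refl

  -- The sorted list has length ℓ + 1 and is read at index h = ⌊ℓ/2⌋. Of 2h ≤ ℓ ≤ 2h + 1, the right
  -- half yields `lower` and the left half `upper`; the counts are then carried along the sorting
  -- permutation.
  median-isMedian : ∀ {ℓ} .{{_ : NonZero ℓ}} (xs : Vec V ℓ) → IsMedian (toList xs) (median G xs)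
  median-isMedian {suc ℓ} xs = record
    { member = ∈-resp-↭ perm (∈-lookup ix)
    ; lower  = subst₂ (λ a b → a ≤ b + b) len (count-↭ (_≼? x)) lo
    ; upper  = subst₂ (λ a b → suc a ≤ b + b) len (count-↭ (x ≼?_)) up
    }
    where
    open Sort decTotalOrder using (sort; sort-↭; sort-↗)
    zs = sort (toList xs)
    perm : zs ↭ toList xs
    perm = sort-↭ (toList xs)
    len : length zs ≡ length (toList xs)
    len = ↭-length perm
    len′ : length zs ≡ suc ℓ
    len′ = trans len (Vec.length-toList xs)
    h = ⌊ ℓ /2⌋
    h< : h < length zs
    h< = subst (h <_) (sym len′) (s≤s (⌊n/2⌋≤n ℓ))
    ix = fromℕ< h<
    x = List.lookup zs ix
    count-↭ : {P : V → Set} (P? : Decidable P) → count P? zs ≡ count P? (toList xs)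
    count-↭ P? = ↭-length (filter-↭ P? perm)
    sorted : AllPairs _≼_ zs
    sorted = Sorted⇒AllPairs (DecTotalOrder.totalOrder decTotalOrder) (sort-↗ (toList xs))
    h+h≤ℓ : h + h ≤ ℓ
    h+h≤ℓ = ≤-trans (+-monoʳ-≤ h (⌊n/2⌋≤⌈n/2⌉ ℓ)) (≤-reflexive (⌊n/2⌋+⌈n/2⌉≡n ℓ))
    ℓ≤1+h+h : ℓ ≤ h + suc h
    ℓ≤1+h+h = ≤-trans (≤-reflexive (sym (⌊n/2⌋+⌈n/2⌉≡n ℓ))) (+-monoʳ-≤ h (⌊n/2⌋-mono (n≤1+n (suc ℓ))))
    lo : length zs ≤ #≼ x zs + #≼ x zs
    lo = begin
      length zs             ≡⟨ len′ ⟩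
      suc ℓ                 ≤⟨ s≤s ℓ≤1+h+h ⟩
      suc h + suc h         ≡⟨ cong (λ i → suc i + suc i) (Fin.toℕ-fromℕ< h<) ⟨
      suc (toℕ ix) + suc (toℕ ix) ≤⟨ +-mono-≤ (#≼-lookup sorted ix) (#≼-lookup sorted ix) ⟩
      #≼ x zs + #≼ x zs     ∎
      where open ≤-Reasoning
    up : suc (length zs) ≤ #≽ x zs + #≽ x zs
    up = +-cancelˡ-≤ ℓ _ _ (begin
      ℓ + suc (length zs)         ≡⟨ cong (λ l → ℓ + suc l) len′ ⟩
      ℓ + suc (suc ℓ)             ≡⟨ +-suc ℓ (suc ℓ) ⟩
      suc ℓ + suc ℓ               ≤⟨ +-mono-≤ up₁ up₁ ⟩
      (h + #≽ x zs) + (h + #≽ x zs) ≡⟨ eq h (#≽ x zs) ⟩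
      (h + h) + (#≽ x zs + #≽ x zs) ≤⟨ +-monoˡ-≤ _ h+h≤ℓ ⟩
      ℓ + (#≽ x zs + #≽ x zs)     ∎)
      where
      open ≤-Reasoning
      up₁ : suc ℓ ≤ h + #≽ x zs
      up₁ = subst₂ (λ a b → a ≤ b + #≽ x zs) len′ (Fin.toℕ-fromℕ< h<) (#≽-lookup sorted ix)
      eq : ∀ a b → (a + b) + (a + b) ≡ (a + a) + (b + b)
      eq = solve-∀

  module Ranks {k : ℕ} (v : Fin k → V) (b : ℕ) .{{_ : NonZero b}} where

    rank : V → ℕ
    rank x = #≼ x (tabulate v)

    Low : Fin k → Set
    Low r = b * b * rank (v r) < k

    low? : Decidable Low
    low? r = b * b * rank (v r) <? k

    private
      instance
        b*b≢0 : NonZero (b * b)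
        b*b≢0 = m*n≢0 b b

    open Penalty low? (b * b) public using (penalty)
    open Penalty low? (b * b) using (∑-penalty; ^count≤∏)

    -- All low counters lie at or below the largest of them, whose rank is less than k/b². As `rank`
    -- includes ties, equal counters cause no difficulty.
    low-bound : b * b * count low? (allFin k) ≤ k
    low-bound with maximum (List.map v (filter low? (allFin k)))
    ... | inj₁ none = subst (λ c → b * b * c ≤ k)
            (trans (cong length (sym none)) (length-map v (filter low? (allFin k))))
            (≤-trans (≤-reflexive (*-zeroʳ (b * b))) z≤n)
    ... | inj₂ (z , z∈ , ≼z) with ∈-map⁻ v z∈
    ...   | (r , r∈ , refl) = ≤-trans (*-monoʳ-≤ (b * b) fewer) (<⇒≤ (proj₂ (∈-filter⁻ low? {xs = allFin k} r∈)))
      where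
      fewer : count low? (allFin k) ≤ rank (v r)
      fewer = ≤-trans
        (count-mono low? (λ r′ → v r′ ≼? v r) {xs = allFin k}
          (All.tabulate (λ {r′} r′∈ low → All.lookup ≼z (∈-map⁺ v (∈-filter⁺ low? r′∈ low)))))
        (≤-reflexive (trans (sym (count-map (_≼? v r) v (allFin k)))
          (cong (#≼ (v r)) (map-tabulate id v))))

    -- One k comes from the default weight 1, the other from b² times the at most k/b² low counters.
    ∑-penalty≤2k : ∑ penalty (allFin k) ≤ 2 * k
    ∑-penalty≤2k = ≤-trans (∑-penalty (allFin k))
      (+-mono-≤ (≤-reflexive (length-tabulate {n = k} id)) (≤-trans low-bound (m≤m+n k 0)))

    1≤∏-penalty : ∀ {ℓ} (s : Vec (Fin k) ℓ) → 1 ≤ ∏ penalty s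
    1≤∏-penalty s = ≤-trans (m^n>0 (b * b) (count no? (toList s))) (^count≤∏ no? (λ _ ()) s)
      where
      no? : Decidable (λ (_ : Fin k) → ⊥)
      no? _ = no λ ()

    -- If c* has low rank then so have all samples below it, which are at
    -- least half of the sample.
    ^≤∏-penalty : ∀ {ℓ} .{{_ : NonZero ℓ}} (s : Vec (Fin k) ℓ) →
                  b * b * rank (median G (Vec.map v s)) < k → b ^ ℓ ≤ ∏ penalty s
    ^≤∏-penalty {ℓ} s low = begin
      b ^ ℓ        ≤⟨ ^-monoʳ-≤ b (subst (_≤ 2 * c) (Vec.length-toList (Vec.map v s))
                        (≤-trans lower (+-monoʳ-≤ c (m≤m+n c 0)))) ⟩
      b ^ (2 * c)  ≡⟨ ^-*-assoc b 2 c ⟨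
      (b ^ 2) ^ c  ≡⟨ cong (λ z → (b * z) ^ c) (*-identityʳ b) ⟩
      (b * b) ^ c  ≡⟨ cong ((b * b) ^_) (trans (cong (#≼ c*) (Vec.toList-map v s)) (count-map (_≼? c*) v (toList s))) ⟩
      (b * b) ^ count (λ r → v r ≼? c*) (toList s)
        ≤⟨ ^count≤∏ (λ r → v r ≼? c*)
             (λ r r≼c* → ≤-<-trans (*-monoʳ-≤ (b * b) (#≼-mono r≼c* (tabulate v))) low) s ⟩
      ∏ penalty s  ∎
      where
      open ≤-Reasoning
      c* = median G (Vec.map v s)
      open IsMedian (median-isMedian (Vec.map v s))
      c = #≼ c* (toList (Vec.map v s))

-- Amortised analysis of the algorithm

module Analysis (G : OrderedAbelianGroup) {m : ℕ} where
  open OrderedAbelianGroup G renaming (Carrier to V)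
  open Order G
  open Assoc (Fin._≟_ {m}) {V}
  open AssocProperties (Fin._≟_ {m}) {V}

  values : Counters G m → List V
  values = List.map proj₂

  valueAt : ∀ {k} (T : Counters G m) → .(k ≤ length T) → Fin k → V
  valueAt T k≤ r = proj₂ (List.lookup T (inject≤ r k≤))

  valueAt∈ : ∀ {k} T .(k≤ : k ≤ length T) r → valueAt T k≤ r ∈ values T
  valueAt∈ T k≤ r = ∈-map⁺ proj₂ (∈-lookup (inject≤ r k≤))

  -- Samples designate the first k entries of `T` only. Ranks among these bound the ranks in `T`
  -- from below, the direction needed to show that many counters are removed.
  #≼-valueAt : ∀ {k} x T .(k≤ : k ≤ length T) → #≼ x (tabulate (valueAt T k≤)) ≤ #≼ x (values T)
  #≼-valueAt {zero}  x T             k≤ = z≤n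
  #≼-valueAt {suc k} x ((_ , c) ∷ T) k≤ with does (c ≼? x)
  ... | true  = s≤s (#≼-valueAt x T (s≤s⁻¹ k≤))
  ... | false = #≼-valueAt x T (s≤s⁻¹ k≤)

  -- Every counter at most `x` becomes nonpositive and is dropped.
  length-decrement : ∀ x T → length (decrement G x T) + #≼ x (values T) ≤ length T
  length-decrement x []            = z≤n
  length-decrement x ((i , c) ∷ T) with c ⊖ x ≼? 0# | c ≼? x
  ... | yes _ | yes _ = ≤-trans (≤-reflexive (+-suc _ _)) (s≤s (length-decrement x T))
  ... | yes _ | no  _ = m≤n⇒m≤1+n (length-decrement x T)
  ... | no ¬0 | yes p = contradiction (≼⇒⊖≼0 p) ¬0
  ... | no  _ | no  _ = s≤s (length-decrement x T)

  afterDecrement : Counters G m → Fin m → V → V → Counters G m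
  afterDecrement T i Δ c* = let T′ = decrement G c* T in
    if does (c* ≼? Δ) then set i (Δ ⊖ c*) T′ else T′

  length-afterDecrement : ∀ T i Δ c* →
    length (afterDecrement T i Δ c*) + #≼ c* (values T) ≤ suc (length T)
  length-afterDecrement T i Δ c* with does (c* ≼? Δ)
  ... | true  = ≤-trans (+-monoˡ-≤ _ (length-set i (Δ ⊖ c*) (decrement G c* T))) (s≤s (length-decrement c* T))
  ... | false = m≤n⇒m≤1+n (length-decrement c* T)

  module _ (b : ℕ) .{{_ : NonZero b}} {k ℓ : ℕ} .{{_ : NonZero ℓ}} where

    calls : Counters G m → Fin m → ℕ
    calls T i with find i T
    ... | just _ = 0
    ... | nothing with length T <? k
    ...   | yes _ = 0
    ...   | no  _ = 1

    factor : Counters G m → Fin m → Vec (Fin k) ℓ → ℕ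
    factor T i s with find i T
    ... | just _ = 2 ^ ℓ
    ... | nothing with length T <? k
    ...   | yes _    = 2 ^ ℓ
    ...   | no |T|≮k = ∏ (Ranks.penalty (valueAt T (≮⇒≥ |T|≮k)) b) s

    -- The three branches of an update, indexed jointly by the new table, the number of calls and
    -- the weight, so that each later lemma matches once instead of repeating the nested case
    -- distinctions of three functions.
    data View (T : Counters G m) (i : Fin m) (Δ : V) (s : Vec (Fin k) ℓ) : Counters G m → ℕ → ℕ → Set where
      hit  : ∀ {c} → find i T ≡ just c → View T i Δ s (set i (c ⊹ Δ) T) 0 (2 ^ ℓ)
      room : find i T ≡ nothing → length T < k → View T i Δ s (set i Δ T) 0 (2 ^ ℓ)
      full : find i T ≡ nothing → (k≤ : k ≤ length T) →
             View T i Δ s (afterDecrement T i Δ (sampleMedian G T k≤ s)) 1 (∏ (Ranks.penalty (valueAt T k≤) b) s)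

    view : ∀ T i Δ s → View T i Δ s (update G T ((i , Δ) , s)) (calls T i) (factor T i s)
    view T i Δ s with find i T in eq
    ... | just _ = hit eq
    ... | nothing with length T <? k
    ...   | yes |T|<k = room eq |T|<k
    ...   | no |T|≮k  = full eq (≮⇒≥ |T|≮k)

    length-step : ∀ {T i Δ s T′ d f} → View T i Δ s T′ d f → length T′ ≤ suc (length T)
    length-step {T} {i} (hit _)    = length-set i _ T
    length-step {T} {i} (room _ _) = length-set i _ T
    length-step {T} {i} {Δ} {s} (full _ k≤) = ≤-trans (m≤m+n _ _) (length-afterDecrement T i Δ (sampleMedian G T k≤ s))

    median∈ : ∀ T (k≤ : k ≤ length T) (s : Vec (Fin k) ℓ) → sampleMedian G T k≤ s ∈ values T
    median∈ T k≤ s with ∈-map⁻ (valueAt T k≤) (subst (sampleMedian G T k≤ s ∈_) (Vec.toList-map (valueAt T k≤) s)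
                          (IsMedian.member (median-isMedian (Vec.map (valueAt T k≤) s))))
    ... | (r , _ , eq) = subst (_∈ values T) (sym eq) (valueAt∈ T k≤ r)

    -- The median is itself one of the counters, so a call always frees at least one place. This
    -- preserves the bound k on the size of the table when the new item is then added.
    1≤#≼median : ∀ T (k≤ : k ≤ length T) (s : Vec (Fin k) ℓ) →
                 1 ≤ #≼ (sampleMedian G T k≤ s) (values T)
    1≤#≼median T k≤ s = filter-some (_≼? c*) (Any.map (λ { refl → ≼-refl }) (median∈ T k≤ s))
      where c* = sampleMedian G T k≤ s

    length≤k : ∀ {T i Δ s T′ d f} → View T i Δ s T′ d f → length T ≤ k → length T′ ≤ k
    length≤k {T} {i} (hit eq)     |T|≤k = ≤-trans (≤-reflexive (length-set-found i _ T eq)) |T|≤k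
    length≤k {T} {i} (room _ lt)  |T|≤k = ≤-trans (length-set i _ T) lt
    length≤k {T} {i} {Δ} {s} (full _ k≤) |T|≤k = ≤-trans (s≤s⁻¹ (≤-trans (≤-trans (≤-reflexive (+-comm 1 _))
      (+-monoʳ-≤ _ (1≤#≼median T k≤ s))) (length-afterDecrement T i Δ (sampleMedian G T k≤ s)))) |T|≤k

    private
      q = 2 ^ ℓ

      k*0+-mono : ∀ {x y} → x ≤ y → k * 0 + b * b * x ≤ b * b * y
      k*0+-mono {x} x≤y = ≤-trans (≤-reflexive (cong (_+ b * b * x) (*-zeroʳ k))) (*-monoʳ-≤ (b * b) x≤y)

    -- g is 1 if the call removes at least a 1/b² fraction of the counters.
    progress : ∀ {T i Δ s T′ d f} → q * q * q ≤ b ^ ℓ → View T i Δ s T′ d f → length T ≤ k →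
               ∃ λ g → k * g + b * b * length T′ ≤ b * b * suc (length T) ×
                       q ^ (1 + 2 * d) ≤ f * q ^ (3 * g)
    progress _ v@(hit _)    _ = 0 , k*0+-mono (length-step v) , ≤-refl
    progress _ v@(room _ _) _ = 0 , k*0+-mono (length-step v) , ≤-refl
    progress {T} {i} {Δ} {s} q³≤ v@(full _ k≤) |T|≤k with b * b * rank c* <? k
      where
      c* = sampleMedian G T k≤ s
      open Ranks (valueAt T k≤) b
    -- A failing call has d = 1 and g = 0, which asks for q³ ≤ f; the penalty of the sample provides
    -- it through q³ ≤ b^ℓ.
    ... | yes low = 0 , k*0+-mono (length-step v) ,
          ≤-trans (≤-reflexive (eq q)) (≤-trans q³≤ (≤-trans (^≤∏-penalty s low) (≤-reflexive (sym (*-identityʳ _)))))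
      where
      open Ranks (valueAt T k≤) b
      eq : ∀ q → q * (q * (q * 1)) ≡ q * q * q
      eq = solve-∀
    -- With g = 1 the granted factor q³ alone covers q^(1 + 2), so f ≥ 1 suffices.
    ... | no ¬low = 1 , gain , ≤-trans (≤-reflexive (sym (+-identityʳ (q ^ 3)))) (*-monoˡ-≤ (q ^ 3) (1≤∏-penalty s))
      where
      c* = sampleMedian G T k≤ s
      open Ranks (valueAt T k≤) b
      T′ = afterDecrement T i Δ c*
      gain : k * 1 + b * b * length T′ ≤ b * b * suc (length T)
      gain = begin
        k * 1 + b * b * length T′ ≡⟨ cong (_+ b * b * length T′) (*-identityʳ k) ⟩
        k + b * b * length T′     ≤⟨ +-monoˡ-≤ _ (≮⇒≥ ¬low) ⟩
        b * b * rank c* + b * b * length T′ ≡⟨ *-distribˡ-+ (b * b) (rank c*) (length T′) ⟨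
        b * b * (rank c* + length T′) ≤⟨ *-monoʳ-≤ (b * b) (+-monoˡ-≤ _ (#≼-valueAt c* T k≤)) ⟩
        b * b * (#≼ c* (values T) + length T′) ≡⟨ cong (b * b *_) (+-comm (#≼ c* (values T)) (length T′)) ⟩
        b * b * (length T′ + #≼ c* (values T)) ≤⟨ *-monoʳ-≤ (b * b) (length-afterDecrement T i Δ c*) ⟩
        b * b * suc (length T) ∎
        where open ≤-Reasoning

    private
      ∑-default : ∑ (λ _ → q) (vectors (allFin k) ℓ) ≤ (2 * k) ^ ℓ
      ∑-default = ≤-reflexive (begin
        ∑ (λ _ → q) (vectors (allFin k) ℓ)   ≡⟨ ∑-const q (vectors (allFin k) ℓ) ⟩
        length (vectors (allFin k) ℓ) * q    ≡⟨ cong (_* q) (length-vectors (allFin k) ℓ) ⟩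
        length (allFin k) ^ ℓ * q            ≡⟨ cong (λ l → l ^ ℓ * q) (length-tabulate {n = k} id) ⟩
        k ^ ℓ * q                            ≡⟨ *-comm (k ^ ℓ) q ⟩
        q * k ^ ℓ                            ≡⟨ ^-distribʳ-* ℓ 2 k ⟨
        (2 * k) ^ ℓ                          ∎)
        where open ≡-Reasoning

    -- The right-hand side is q times the number k^ℓ of samples. The bound does not depend on `T`,
    -- which is what makes the induction over the stream possible.
    ∑-factor : ∀ T i → ∑ (factor T i) (vectors (allFin k) ℓ) ≤ (2 * k) ^ ℓ
    ∑-factor T i with find i T
    ... | just _ = ∑-default
    ... | nothing with length T <? k
    ...   | yes _ = ∑-default
    ...   | no |T|≮k = ≤-trans (≤-reflexive (∑-∏ penalty (allFin k) ℓ)) (^-monoˡ-≤ ℓ ∑-penalty≤2k)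
      where open Ranks (valueAt T (≮⇒≥ |T|≮k)) b

    totalCalls : ∀ {n} → Counters G m → Stream G m n → Tape k ℓ n → ℕ
    totalCalls T []             []      = 0
    totalCalls T ((i , Δ) ∷ xs) (s ∷ ω) = calls T i + totalCalls (update G T ((i , Δ) , s)) xs ω

    totalFactor : ∀ {n} → Counters G m → Stream G m n → Tape k ℓ n → ℕ
    totalFactor T []             []      = 1
    totalFactor T ((i , Δ) ∷ xs) (s ∷ ω) = factor T i s * totalFactor (update G T ((i , Δ) , s)) xs ω

    -- The first sample determines the next table; the sum over the remaining tapes is bounded
    -- whatever that table is, so the bound can be pulled out before summing over the first sample.
    ∑-totalFactor : ∀ {n} T (xs : Stream G m n) → ∑ (totalFactor T xs) (tapes k ℓ n) ≤ ((2 * k) ^ ℓ) ^ n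
    ∑-totalFactor T []                     = ≤-refl
    ∑-totalFactor {suc n} T ((i , Δ) ∷ xs) = begin
      ∑ (totalFactor T ((i , Δ) ∷ xs)) (tapes k ℓ (suc n))
        ≡⟨ ∑-vectors (totalFactor T ((i , Δ) ∷ xs)) samples ⟩
      ∑ (λ s → ∑ (λ ω → factor T i s * totalFactor (next s) xs ω) (tapes k ℓ n)) samples
        ≤⟨ ∑-mono (λ s → ≤-trans (≤-reflexive (∑-*ˡ (factor T i s) (totalFactor (next s) xs) (tapes k ℓ n)))
             (*-monoʳ-≤ (factor T i s) (∑-totalFactor (next s) xs))) samples ⟩
      ∑ (λ s → factor T i s * M ^ n) samples  ≡⟨ ∑-*ʳ (factor T i) (M ^ n) samples ⟩
      ∑ (factor T i) samples * M ^ n          ≤⟨ *-monoˡ-≤ (M ^ n) (∑-factor T i) ⟩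
      M ^ suc n ∎
      where
      open ≤-Reasoning
      M = (2 * k) ^ ℓ
      samples = vectors (allFin k) ℓ
      next : Vec (Fin k) ℓ → Counters G m
      next s = update G T ((i , Δ) , s)

    -- The per-update inequalities telescope, with b² times the size of the table as potential: each
    -- update raises the size by at most one, and each of the `g` effective calls pays k out of the
    -- potential.
    totalProgress : ∀ {n} → q * q * q ≤ b ^ ℓ → ∀ T (xs : Stream G m n) (ω : Tape k ℓ n) → length T ≤ k →
      ∃ λ g → k * g ≤ b * b * (n + length T) ×
              q ^ (n + 2 * totalCalls T xs ω) ≤ totalFactor T xs ω * q ^ (3 * g)
    totalProgress h T []             []      _ = 0 , ≤-trans (≤-reflexive (*-zeroʳ k)) z≤n , ≤-refl
    totalProgress {suc n} h T ((i , Δ) ∷ xs) (s ∷ ω) |T|≤k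
      with progress h (view T i Δ s) |T|≤k
         | totalProgress h (update G T ((i , Δ) , s)) xs ω (length≤k (view T i Δ s) |T|≤k)
    ... | (g , kg≤ , f≥) | (g′ , kg′≤ , F≥) = g + g′ , budget , growth
      where
      open ≤-Reasoning
      T′ = update G T ((i , Δ) , s)
      d = calls T i
      D = totalCalls T′ xs ω
      budget : k * (g + g′) ≤ b * b * (suc n + length T)
      budget = begin
        k * (g + g′)                             ≡⟨ *-distribˡ-+ k g g′ ⟩
        k * g + k * g′                           ≤⟨ +-monoʳ-≤ (k * g) kg′≤ ⟩
        k * g + b * b * (n + length T′)          ≡⟨ eq (k * g) (b * b) n (length T′) ⟩
        (k * g + b * b * length T′) + b * b * n  ≤⟨ +-monoˡ-≤ (b * b * n) kg≤ ⟩
        b * b * suc (length T) + b * b * n       ≡⟨ eq′ (b * b) n (length T) ⟩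
        b * b * (suc n + length T)               ∎
        where
        eq : ∀ x c n t → x + c * (n + t) ≡ (x + c * t) + c * n
        eq = solve-∀
        eq′ : ∀ c n t → c * suc t + c * n ≡ c * (suc n + t)
        eq′ = solve-∀
      growth : q ^ (suc n + 2 * (d + D)) ≤ (factor T i s * totalFactor T′ xs ω) * q ^ (3 * (g + g′))
      growth = begin
        q ^ (suc n + 2 * (d + D))                ≡⟨ cong (q ^_) (eq n d D) ⟩
        q ^ ((1 + 2 * d) + (n + 2 * D))          ≡⟨ ^-distribˡ-+-* q (1 + 2 * d) (n + 2 * D) ⟩
        q ^ (1 + 2 * d) * q ^ (n + 2 * D)        ≤⟨ *-mono-≤ f≥ F≥ ⟩
        (f * q ^ (3 * g)) * (F * q ^ (3 * g′))   ≡⟨ eq′ f (q ^ (3 * g)) F (q ^ (3 * g′)) ⟩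
        (f * F) * (q ^ (3 * g) * q ^ (3 * g′))   ≡⟨ cong ((f * F) *_) (^-distribˡ-+-* q (3 * g) (3 * g′)) ⟨
        (f * F) * q ^ (3 * g + 3 * g′)           ≡⟨ cong (λ e → (f * F) * q ^ e) (*-distribˡ-+ 3 g g′) ⟨
        (f * F) * q ^ (3 * (g + g′))             ∎
        where
        f = factor T i s
        F = totalFactor T′ xs ω
        eq : ∀ n d D → suc n + 2 * (d + D) ≡ (1 + 2 * d) + (n + 2 * D)
        eq = solve-∀
        eq′ : ∀ a b c d → (a * b) * (c * d) ≡ (a * c) * (b * d)
        eq′ = solve-∀

    -- A call needs a full table, and an update adds at most one counter. This settles n < k, where
    -- the cost k of even one enumeration could not be charged to the stream.
    no-calls : ∀ {n} T (xs : Stream G m n) (ω : Tape k ℓ n) → n + length T < k → totalCalls T xs ω ≡ 0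
    no-calls T []             []      _ = refl
    no-calls {suc n} T ((i , Δ) ∷ xs) (s ∷ ω) n+|T|<k = cong₂ _+_
      (none (view T i Δ s))
      (no-calls _ xs ω (≤-<-trans (≤-trans (+-monoʳ-≤ n (length-step (view T i Δ s))) (≤-reflexive (+-suc n _))) n+|T|<k))
      where
      none : ∀ {T′ d f} → View T i Δ s T′ d f → d ≡ 0
      none (hit _)     = refl
      none (room _ _)  = refl
      none (full _ k≤) = contradiction (≤-<-trans (≤-trans k≤ (m≤n+m _ (suc n))) n+|T|<k) (<-irrefl refl)

-- Tail bound on the number of calls, and the choice of ℓ

module _ (G : OrderedAbelianGroup) {m : ℕ} (b : ℕ) .{{_ : NonZero b}} {k ℓ n : ℕ} .{{_ : NonZero k}} .{{_ : NonZero ℓ}} where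
  open Analysis G {m}

  -- With more than K calls, 2D exceeds E + 3g, so q^(n + 2D) ≤ F * q^(3g) forces the total weight F
  -- up to q^E * q^n ≥ n * q^n. This is n times the bound q^n on its average, and Markov's
  -- inequality applies.
  few-calls : (2 ^ ℓ) * (2 ^ ℓ) * (2 ^ ℓ) ≤ b ^ ℓ → (K E : ℕ) → n ≤ (2 ^ ℓ) ^ E →
              (∀ g → k * g ≤ b * b * n → E + 3 * g ≤ 2 * K) → (xs : Stream G m n) →
              n * length (filter (λ ω → K <? totalCalls b {k} {ℓ} [] xs ω) (tapes k ℓ n)) ≤ length (tapes k ℓ n)
  few-calls q³≤ K E n≤q^E spare xs = *-cancelʳ-≤ _ _ (q ^ n) {{m^n≢0 q n}} (begin
    n * bad * q ^ n     ≡⟨ eq n bad (q ^ n) ⟩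
    bad * (n * q ^ n)   ≤⟨ markov bad? (totalFactor b [] xs) (n * q ^ n) heavy (tapes k ℓ n) ⟩
    ∑ (totalFactor b [] xs) (tapes k ℓ n) ≤⟨ ∑-totalFactor b [] xs ⟩
    ((2 * k) ^ ℓ) ^ n   ≡⟨ cong (_^ n) (^-distribʳ-* ℓ 2 k) ⟩
    (q * k ^ ℓ) ^ n     ≡⟨ ^-distribʳ-* n q (k ^ ℓ) ⟩
    q ^ n * (k ^ ℓ) ^ n ≡⟨ *-comm (q ^ n) _ ⟩
    (k ^ ℓ) ^ n * q ^ n ≡⟨ cong (_* q ^ n) (length-tapes k ℓ n) ⟨
    length (tapes k ℓ n) * q ^ n ∎)
    where
    open ≤-Reasoning
    q = 2 ^ ℓ
    instance
      q≢0 : NonZero q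
      q≢0 = m^n≢0 2 ℓ
    bad? = λ ω → K <? totalCalls b {k} {ℓ} [] xs ω
    bad = length (filter bad? (tapes k ℓ n))
    eq : ∀ n x y → n * x * y ≡ x * (n * y)
    eq = solve-∀
    heavy : ∀ ω → K < totalCalls b [] xs ω → n * q ^ n ≤ totalFactor b [] xs ω
    heavy ω K<D with totalProgress b q³≤ [] xs ω z≤n
    ... | (g , kg≤ , growth) = *-cancelʳ-≤ _ _ (q ^ (3 * g)) {{m^n≢0 q (3 * g)}} (begin
      n * q ^ n * q ^ (3 * g)       ≤⟨ *-monoˡ-≤ (q ^ (3 * g)) (*-monoˡ-≤ (q ^ n) n≤q^E) ⟩
      q ^ E * q ^ n * q ^ (3 * g)   ≡⟨ cong (_* q ^ (3 * g)) (^-distribˡ-+-* q E n) ⟨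
      q ^ (E + n) * q ^ (3 * g)     ≡⟨ ^-distribˡ-+-* q (E + n) (3 * g) ⟨
      q ^ (E + n + 3 * g)           ≤⟨ ^-monoʳ-≤ q exponent ⟩
      q ^ (n + 2 * D)               ≤⟨ growth ⟩
      totalFactor b [] xs ω * q ^ (3 * g) ∎)
      where
      D = totalCalls b {k} {ℓ} [] xs ω
      eq′ : ∀ a b c → a + b + c ≡ b + (a + c)
      eq′ = solve-∀
      exponent : E + n + 3 * g ≤ n + 2 * D
      exponent = begin
        E + n + 3 * g    ≡⟨ eq′ E n (3 * g) ⟩
        n + (E + 3 * g)  ≤⟨ +-monoʳ-≤ n (spare g (subst (λ z → k * g ≤ b * b * z) (+-identityʳ n) kg≤)) ⟩
        n + 2 * K        ≤⟨ +-monoʳ-≤ n (*-monoʳ-≤ 2 (<⇒≤ K<D)) ⟩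
        n + 2 * D        ∎

-- Estimates for the binary logarithm

n<2^1+⌊log₂n⌋ : ∀ n → n < 2 ^ suc ⌊log₂ n ⌋
n<2^1+⌊log₂n⌋ n = ≰⇒> λ 2^≤n → 1+n≰n (≤-trans (≤-reflexive (sym (⌊log₂[2^n]⌋≡n (suc ⌊log₂ n ⌋)))) (⌊log₂⌋-mono-≤ 2^≤n))

-- Induction on the value of the logarithm: halving the argument lowers it by one.
2^⌊log₂n⌋≤n : ∀ n .{{_ : NonZero n}} → 2 ^ ⌊log₂ n ⌋ ≤ n
2^⌊log₂n⌋≤n n = go n ⌊log₂ n ⌋ refl
  where
  go : ∀ n .{{_ : NonZero n}} L → ⌊log₂ n ⌋ ≡ L → 2 ^ L ≤ n
  go n             zero    _  = >-nonZero⁻¹ n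
  go (suc (suc n)) (suc L) eq = begin
    2 * 2 ^ L                ≤⟨ *-monoʳ-≤ 2 (go (suc h) L (trans (⌊log₂⌊n/2⌋⌋≡⌊log₂n⌋∸1 (suc (suc n))) (cong (_∸ 1) eq))) ⟩
    2 * suc h                ≡⟨ cong (λ z → suc h + z) (+-identityʳ (suc h)) ⟩
    suc h + suc h            ≤⟨ +-monoʳ-≤ (suc h) (s≤s (⌊n/2⌋≤⌈n/2⌉ n)) ⟩
    suc h + suc ⌈ n /2⌉      ≡⟨ ⌊n/2⌋+⌈n/2⌉≡n (suc (suc n)) ⟩
    suc (suc n)              ∎
    where
    open ≤-Reasoning
    h = ⌊ n /2⌋

-- This makes log³ n = O(n) explicit. The shift by 4 is the least for which consecutive cubes always
-- grow by a factor of at most 2 (125 ≤ 2 * 64), and 64 = 4³ turns the base case into an equality.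
[4+n]³≤64*2^n : ∀ n → (4 + n) * (4 + n) * (4 + n) ≤ 64 * 2 ^ n
[4+n]³≤64*2^n zero    = ≤-refl
[4+n]³≤64*2^n (suc n) = begin
  -- The added polynomial is the difference 2(4 + n)³ - (5 + n)³, whose coefficients are all
  -- positive.
  (5 + n) * (5 + n) * (5 + n)        ≤⟨ m≤m+n _ (n * n * n + 9 * (n * n) + 21 * n + 3) ⟩
  (5 + n) * (5 + n) * (5 + n) + (n * n * n + 9 * (n * n) + 21 * n + 3) ≡⟨ eq n ⟩
  2 * ((4 + n) * (4 + n) * (4 + n))  ≤⟨ *-monoʳ-≤ 2 ([4+n]³≤64*2^n n) ⟩
  2 * (64 * 2 ^ n)                   ≡⟨ eq′ 64 (2 ^ n) ⟩
  64 * (2 * 2 ^ n)                   ∎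
  where
  open ≤-Reasoning
  eq : ∀ n → (5 + n) * (5 + n) * (5 + n) + (n * n * n + 9 * (n * n) + 21 * n + 3) ≡ 2 * ((4 + n) * (4 + n) * (4 + n))
  eq = solve-∀
  eq′ : ∀ c x → 2 * (c * x) ≡ c * (2 * x)
  eq′ = solve-∀

-- One sample suffices as long as k log n ≤ n, since then Ω(log n) calls are
-- affordable; otherwise only O(log n) calls are made and each can afford
-- time quadratic in log n.
sampleSize : ℕ → ℕ → ℕ
sampleSize n k with k * ⌊log₂ n ⌋ ≤? n
... | yes _ = 1
... | no  _ = suc ⌊log₂ n ⌋

sampleSize≢0 : ∀ n k → NonZero (sampleSize n k)
sampleSize≢0 n k with k * ⌊log₂ n ⌋ ≤? n
... | yes _ = _
... | no  _ = _

sampleSize≤ : ∀ n k → 2 ≤ n → sampleSize n k ≤ 2 * ⌊log₂ n ⌋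
sampleSize≤ n k 2≤n with ⌊log₂⌋-mono-≤ 2≤n | k * ⌊log₂ n ⌋ ≤? n
... | 1≤L | yes _ = ≤-trans 1≤L (m≤m+n _ _)
... | 1≤L | no  _ = +-mono-≤ 1≤L (m≤m+n ⌊log₂ n ⌋ 0)

-- K is the number of calls exceeded with probability at most 1/n, and E
-- pays for the factor n in the tail bound.
module _ (c : ℕ) where

  -- The term 3c * 2 + 2 comes from `calls*k≤` and is doubled for ℓ = 1, where k + 1 ≤ 2k; the term
  -- (3c + 1) * 64 pays for ℓ² when ℓ = 1 + log n. Their sum serves both cases.
  budgetFactor : ℕ
  budgetFactor = 2 * (3 * c * 2 + 2) + (3 * c + 1) * 64

  callBudget : ∀ n k .{{_ : NonZero n}} .{{_ : NonZero k}} → let ℓ = sampleSize n k in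
    ∃₂ λ K E → n ≤ (2 ^ ℓ) ^ E × (∀ g → k * g ≤ c * n → E + 3 * g ≤ 2 * K)
             × (k ≤ n → K * (k + ℓ * ℓ) ≤ budgetFactor * n)
  callBudget n k = result
    where
    open ≤-Reasoning
    L Q : ℕ
    L = ⌊log₂ n ⌋
    Q = n DivMod./ k
    n<[1+Q]k : n < suc Q * k
    n<[1+Q]k = subst (_< k + Q * k) (sym (m≡m%n+[m/n]*n n k)) (+-monoˡ-< (Q * k) (m%n<n n k))
    -- From kg ≤ cn and n < (1 + Q)k follows g ≤ c(1 + Q). Half of 3c(1 + Q) + E would do; taking
    -- all of it avoids rounding.
    calls : ℕ → ℕ
    calls E = 3 * c * suc Q + E
    room : ∀ E g → k * g ≤ c * n → E + 3 * g ≤ 2 * calls E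
    room E g kg≤ = begin
      E + 3 * g               ≤⟨ +-monoʳ-≤ E (*-monoʳ-≤ 3 g≤) ⟩
      E + 3 * (c * suc Q)     ≤⟨ m≤m+n _ _ ⟩
      E + 3 * (c * suc Q) + (3 * c * suc Q + E) ≡⟨ eq c (suc Q) E ⟩
      2 * calls E ∎
      where
      eq : ∀ c q e → e + 3 * (c * q) + (3 * c * q + e) ≡ 2 * (3 * c * q + e)
      eq = solve-∀
      eq′ : ∀ c q k → c * (q * k) ≡ k * (c * q)
      eq′ = solve-∀
      g≤ : g ≤ c * suc Q
      g≤ = *-cancelˡ-≤ k (begin
        k * g            ≤⟨ kg≤ ⟩
        c * n            ≤⟨ *-monoʳ-≤ c (<⇒≤ n<[1+Q]k) ⟩
        c * (suc Q * k)  ≡⟨ eq′ c (suc Q) k ⟩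
        k * (c * suc Q)  ∎)
    calls*k≤ : ∀ E → k * E ≤ 2 * n → k ≤ n → calls E * k ≤ (3 * c * 2 + 2) * n
    calls*k≤ E kE≤ k≤n = begin
      calls E * k                          ≡⟨ eq c Q E k ⟩
      3 * c * (k + Q * k) + k * E          ≤⟨ +-mono-≤ (*-monoʳ-≤ (3 * c) (+-mono-≤ k≤n (m/n*n≤m n k))) kE≤ ⟩
      3 * c * (n + n) + 2 * n              ≡⟨ eq′ c n ⟩
      (3 * c * 2 + 2) * n                  ∎
      where
      eq : ∀ c q e k → (3 * c * suc q + e) * k ≡ 3 * c * (k + q * k) + k * e
      eq = solve-∀
      eq′ : ∀ c n → 3 * c * (n + n) + 2 * n ≡ (3 * c * 2 + 2) * n
      eq′ = solve-∀
    result : let ℓ = sampleSize n k in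
      ∃₂ λ K E → n ≤ (2 ^ ℓ) ^ E × (∀ g → k * g ≤ c * n → E + 3 * g ≤ 2 * K)
             × (k ≤ n → K * (k + ℓ * ℓ) ≤ budgetFactor * n)
    result with k * ⌊log₂ n ⌋ ≤? n
    -- For ℓ = 1 the base is only 2, so E has to be 1 + L to reach n; kL ≤ n keeps the resulting k(1
    -- + L) at most 2n.
    ... | yes kL≤n = calls (suc L) , suc L , <⇒≤ (n<2^1+⌊log₂n⌋ n) , room (suc L) , λ k≤n → begin
          calls (suc L) * (k + 1)           ≤⟨ *-monoʳ-≤ (calls (suc L)) (+-monoʳ-≤ k (>-nonZero⁻¹ k)) ⟩
          calls (suc L) * (k + k)           ≡⟨ eq (calls (suc L)) k ⟩
          2 * (calls (suc L) * k)           ≤⟨ *-monoʳ-≤ 2 (calls*k≤ (suc L)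
            (≤-trans (≤-reflexive (*-suc k L)) (+-mono-≤ k≤n (≤-trans kL≤n (m≤m+n n 0)))) k≤n) ⟩
          2 * ((3 * c * 2 + 2) * n)         ≡⟨ *-assoc 2 (3 * c * 2 + 2) n ⟨
          2 * (3 * c * 2 + 2) * n           ≤⟨ *-monoˡ-≤ n (m≤m+n (2 * (3 * c * 2 + 2)) _) ⟩
          (2 * (3 * c * 2 + 2) + (3 * c + 1) * 64) * n ∎
      where
      eq : ∀ x k → x * (k + k) ≡ 2 * (x * k)
      eq = solve-∀
    -- For ℓ = 1 + L a single factor 2^ℓ already exceeds n, so E = 1. What remains is the ℓ² spent
    -- on each call.
    ... | no kL≰n = calls 1 , 1 , ≤-trans (<⇒≤ (n<2^1+⌊log₂n⌋ n)) (≤-reflexive (sym (*-identityʳ _))) , room 1 , λ k≤n → begin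
          calls 1 * (k + suc L * suc L)     ≡⟨ *-distribˡ-+ (calls 1) k (suc L * suc L) ⟩
          calls 1 * k + calls 1 * (suc L * suc L)
            ≤⟨ +-mono-≤ (calls*k≤ 1 (≤-trans (≤-reflexive (*-identityʳ k)) (≤-trans k≤n (m≤m+n n _))) k≤n) squares ⟩
          (3 * c * 2 + 2) * n + (3 * c + 1) * 64 * n
            ≡⟨ *-distribʳ-+ n (3 * c * 2 + 2) ((3 * c + 1) * 64) ⟨
          ((3 * c * 2 + 2) + (3 * c + 1) * 64) * n
            ≤⟨ *-monoˡ-≤ n (+-monoˡ-≤ ((3 * c + 1) * 64) (m≤m+n (3 * c * 2 + 2) _)) ⟩
          (2 * (3 * c * 2 + 2) + (3 * c + 1) * 64) * n ∎
      where
      -- Since Qk ≤ n < kL. Hence at most (3c + 1)L calls are budgeted, and their ℓ² terms add up to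
      -- O(log³ n).
      Q<L : Q < L
      Q<L = *-cancelʳ-< k Q L (≤-<-trans (m/n*n≤m n k) (<-≤-trans (≰⇒> kL≰n) (≤-reflexive (*-comm k L))))
      squares : calls 1 * (suc L * suc L) ≤ (3 * c + 1) * 64 * n
      squares = begin
        calls 1 * (suc L * suc L) ≤⟨ *-monoˡ-≤ (suc L * suc L) (+-mono-≤ (*-monoʳ-≤ (3 * c) Q<L) (≤-trans (s≤s z≤n) Q<L)) ⟩
        (3 * c * L + L) * (suc L * suc L) ≡⟨ eq c L (suc L * suc L) ⟩
        (3 * c + 1) * (L * (suc L * suc L)) ≤⟨ *-monoʳ-≤ (3 * c + 1) (*-mono-≤ (m≤n+m L 4) (*-mono-≤ 1+L≤4+L 1+L≤4+L)) ⟩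
        (3 * c + 1) * ((4 + L) * ((4 + L) * (4 + L))) ≡⟨ cong ((3 * c + 1) *_) (*-assoc (4 + L) (4 + L) (4 + L)) ⟨
        (3 * c + 1) * ((4 + L) * (4 + L) * (4 + L)) ≤⟨ *-monoʳ-≤ (3 * c + 1) ([4+n]³≤64*2^n L) ⟩
        (3 * c + 1) * (64 * 2 ^ L) ≤⟨ *-monoʳ-≤ (3 * c + 1) (*-monoʳ-≤ 64 (2^⌊log₂n⌋≤n n)) ⟩
        (3 * c + 1) * (64 * n) ≡⟨ *-assoc (3 * c + 1) 64 n ⟨
        (3 * c + 1) * 64 * n ∎
        where
        1+L≤4+L : suc L ≤ 4 + L
        1+L≤4+L = s≤s (m≤n+m L 3)
        eq : ∀ c l x → (3 * c * l + l) * x ≡ (3 * c + 1) * (l * x)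
        eq = solve-∀

-- The program and its running time

-- Memory layout.  Words: 0 = k, 1 = ℓ, 2 = item, 3 = number of counters,
-- 4 = lookup flag, 5 and 8 = loop indices, 6 and 7 = tallies, and the keys
-- from 10 on.  Weights: 0 = Δ, 1 = value found, 2 = candidate median,
-- 3 = c*, 4 = decremented counter, the counters from 10 on, and the sample
-- from 10 + k on.

increment : ℕ → Program
increment x = lit x ≔ lit 1 ⊕ mem (lit x)

sampleAt : Word → Word
sampleAt j = lit 10 ⊕ (mem (lit 0) ⊕ j)

-- Word 6 holds the drawn index here, before it becomes a tally. The sampled value goes behind the k
-- enumerated counters.
drawSample : Program
drawSample =
  sample (lit 6) ⨾
  sampleAt (mem (lit 5)) ≔ʷ mem (lit 10 ⊕ mem (lit 6)) ⨾
  increment 5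

compareSample : Program
compareSample =
  (test mem (sampleAt (mem (lit 8))) ≤ʷ mem (lit 2) then increment 6 else skip) ⨾
  (test mem (lit 2) ≤ʷ mem (sampleAt (mem (lit 8))) then increment 7 else skip) ⨾
  increment 8

loadCandidate : Program
loadCandidate =
  lit 2 ≔ʷ mem (sampleAt (mem (lit 5))) ⨾
  lit 6 ≔ lit 0 ⨾
  lit 7 ≔ lit 0 ⨾
  lit 8 ≔ lit 0

-- The two tests are the fields `lower` and `upper` of `IsMedian`, with ℓ as the length and the
-- tallies as the counts.
acceptCandidate : Program
acceptCandidate =
  (test mem (lit 1) ≤ mem (lit 6) ⊕ mem (lit 6)
   then (test lit 1 ⊕ mem (lit 1) ≤ mem (lit 7) ⊕ mem (lit 7)
         then lit 3 ≔ʷ mem (lit 2)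
         else skip)
   else skip) ⨾
  increment 5

tryCandidate : Program
tryCandidate = loadCandidate ⨾ (repeat mem (lit 1) times compareSample) ⨾ acceptCandidate

decrementNext : Program
decrementNext =
  lit 4 ≔ʷ mem (lit 10 ⊕ mem (lit 5)) ⊝ mem (lit 3) ⨾
  -- Weight expressions have no literals, so `0#` is produced as c* minus itself.
  (test mem (lit 4) ≤ʷ mem (lit 3) ⊝ mem (lit 3)
   then (delete (mem (lit 10 ⊕ mem (lit 5))) ⨾ lit 3 ≔ mem (lit 3) ⊝ lit 1)
   else insert (mem (lit 10 ⊕ mem (lit 5))) (mem (lit 4))) ⨾
  increment 5

insertRest : Program
insertRest =
  test mem (lit 3) ≤ʷ mem (lit 0)
  then (insert (mem (lit 2)) (mem (lit 0) ⊝ mem (lit 3)) ⨾ increment 3)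
  else skip

loop : ℕ → Program → Program
loop n p = lit 5 ≔ lit 0 ⨾ (repeat mem (lit n) times p)

evict : Program
evict = loop 1 drawSample ⨾ loop 1 tryCandidate ⨾ loop 0 decrementNext ⨾ insertRest

addNew : Program
addNew = insert (mem (lit 2)) (mem (lit 0)) ⨾ increment 3

addOld : Program
addOld = insert (mem (lit 2)) (mem (lit 1) ⊕ mem (lit 0))

findItem : Program
findItem = lookup (mem (lit 2)) (lit 4) (lit 1)

replace : Program
replace = enumerate (lit 10) (lit 10) ⨾ evict

addMissing : Program
addMissing = test lit 1 ⊕ mem (lit 3) ≤ mem (lit 0) then addNew else replace

dispatch : Program
dispatch = test lit 1 ≤ mem (lit 4) then addOld else addMissing

updateProgram : Program
updateProgram = findItem ⨾ dispatch

module Memory (G : OrderedAbelianGroup) where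
  open Machine G

  ↦-other : {A : Set} (f : ℕ → A) {x y : ℕ} {v : A} → y ≢ x → (f [ x ↦ v ]) y ≡ f y
  ↦-other f {x} {y} {v} y≢x = cong (λ b → if b then v else f y) (dec-false (y ≟ x) y≢x)

  ↦-same : {A : Set} (f : ℕ → A) (x : ℕ) {v : A} → (f [ x ↦ v ]) x ≡ v
  ↦-same f x {v} = cong (λ b → if b then v else f x) (dec-true (x ≟ x) refl)

-- Syntactic bounds on the running time

module Cost (k ℓ : ℕ) where

  -- A static lower bound on an address, enough to see that an assignment leaves words 0 and 1
  -- alone. Nothing is assumed about memory contents, hence 0 for `mem`.
  lowerBound : Word → ℕ
  lowerBound (lit c) = c
  lowerBound (mem e) = 0
  lowerBound (e ⊕ f) = lowerBound e + lowerBound f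
  lowerBound (e ⊝ f) = 0

  iterations : Word → Maybe ℕ
  iterations (mem (lit 0)) = just k
  iterations (mem (lit 1)) = just ℓ
  iterations _             = nothing

  -- Words 0 and 1 are never written, and loops run k or ℓ times.
  Bounded : Program → Set
  Bounded skip                          = ⊤
  Bounded (e ≔ f)                       = T (2 ≤ᵇ lowerBound e)
  Bounded (e ≔ʷ v)                      = ⊤
  Bounded (p ⨾ q)                       = Bounded p × Bounded q
  Bounded (test e ≤ f then p else q)    = Bounded p × Bounded q
  Bounded (test v ≤ʷ w then p else q)   = Bounded p × Bounded q
  Bounded (repeat e times p)            = T (is-just (iterations e)) × Bounded p
  Bounded (sample e)                    = T (2 ≤ᵇ lowerBound e)
  Bounded (lookup e f g)                = T (2 ≤ᵇ lowerBound f)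
  Bounded (insert e v)                  = ⊤
  Bounded (delete e)                    = ⊤
  Bounded (enumerate e f)               = ⊥

  -- Both branches of a test are charged, which makes the bound a polynomial in k and ℓ. The
  -- excluded `enumerate` is accounted for by the summand 3 + k of `callCost`.
  bound : Program → ℕ
  bound skip                          = 1
  bound (e ≔ f)                       = 1 + wordCost e + wordCost f
  bound (e ≔ʷ v)                      = 1 + wordCost e + weightCost v
  bound (p ⨾ q)                       = bound p + bound q
  bound (test e ≤ f then p else q)    = (1 + wordCost e + wordCost f) + (bound p + bound q)
  bound (test v ≤ʷ w then p else q)   = (1 + weightCost v + weightCost w) + (bound p + bound q)
  bound (repeat e times p)            = (1 + wordCost e) + maybe id 0 (iterations e) * (1 + bound p)
  bound (sample e)                    = 1 + wordCost e
  bound (lookup e f g)                = 1 + wordCost e + wordCost f + wordCost g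
  bound (insert e v)                  = 1 + wordCost e + weightCost v
  bound (delete e)                    = 1 + wordCost e
  bound (enumerate e f)               = 0

  testCost₁ testCost₂ baseCost callCost : ℕ
  testCost₁ = 1 + wordCost (lit 1) + wordCost (mem (lit 4))
  testCost₂ = 1 + wordCost (lit 1 ⊕ mem (lit 3)) + wordCost (mem (lit 0))
  baseCost = bound findItem + (testCost₁ + (testCost₂ + (bound addOld + bound addNew)))
  callCost = 3 + k + bound evict

  -- The sum of the four coefficients in `expand`. None of the programs occurring in it contains a
  -- loop, so it does not vary with k and ℓ.
  callCoefficient : ℕ
  callCoefficient = bound insertRest + 21 + (bound decrementNext + 2) + (bound drawSample + bound loadCandidate + bound acceptCandidate + 5) + (bound compareSample + 1)

  callCost≤ : .{{_ : NonZero k}} .{{_ : NonZero ℓ}} → callCost ≤ callCoefficient * (k + ℓ * ℓ)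
  callCost≤ = ≤-trans (≤-reflexive (expand k ℓ (bound drawSample) (bound loadCandidate) (bound compareSample)
      (bound acceptCandidate) (bound decrementNext) (bound insertRest)))
    (quadratic (bound insertRest + 21) (bound decrementNext + 2)
      (bound drawSample + bound loadCandidate + bound acceptCandidate + 5) (bound compareSample + 1))
    where
    expand : ∀ k ℓ d l c a e i →
      3 + k + ((3 + (3 + ℓ * (1 + d))) + ((3 + (3 + ℓ * (1 + (l + ((3 + ℓ * (1 + c)) + a))))) + ((3 + (3 + k * (1 + e))) + i)))
      ≡ (i + 21) * 1 + (e + 2) * k + (d + l + a + 5) * ℓ + (c + 1) * (ℓ * ℓ)
    expand = solve-∀
    -- As k and ℓ are positive, each of 1, k, ℓ and ℓ² is at most k + ℓ².
    quadratic : ∀ p q r t → p * 1 + q * k + r * ℓ + t * (ℓ * ℓ) ≤ (p + q + r + t) * (k + ℓ * ℓ)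
    quadratic p q r t = ≤-trans
      (+-mono-≤ (+-mono-≤ (+-mono-≤ (*-monoʳ-≤ p (≤-trans (>-nonZero⁻¹ k) (m≤m+n k _))) (*-monoʳ-≤ q (m≤m+n k _)))
        (*-monoʳ-≤ r (≤-trans (m≤m*n ℓ ℓ) (m≤n+m _ k)))) (*-monoʳ-≤ t (m≤n+m _ k)))
      (≤-reflexive (eq p q r t (k + ℓ * ℓ)))
      where
      eq : ∀ p q r t s → p * s + q * s + r * s + t * s ≡ (p + q + r + t) * s
      eq = solve-∀

  module _ (G : OrderedAbelianGroup) where
    open OrderedAbelianGroup G using (_≼?_) renaming (Carrier to V)
    open Machine G
    open State
    open Memory G

    charges : State → ℕ
    charges σ = ∑ (charge k) (hashOps σ)

    -- The same `c` bounds the steps and the hash charges, each separately. Preservation of words 0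
    -- and 1 is included because the loops read their counts from them.
    record Within (c : ℕ) (σ σ′ : State) : Set where
      constructor within
      field
        word₀    : words σ 0 ≡ k → words σ′ 0 ≡ k
        word₁    : words σ 1 ≡ ℓ → words σ′ 1 ≡ ℓ
        steps≤   : steps σ′ ≤ c + steps σ
        charges≤ : charges σ′ ≤ c + charges σ

    within-trans : ∀ {c d σ σ′ σ″} → Within c σ σ′ → Within d σ′ σ″ → Within (c + d) σ σ″
    within-trans {c} {d} {σ} (within w₀ w₁ s ch) (within w₀′ w₁′ s′ ch′) = within
      (λ e → w₀′ (w₀ e)) (λ e → w₁′ (w₁ e)) (add s s′) (add ch ch′)
      where
      add : ∀ {x y z} → y ≤ c + x → z ≤ d + y → z ≤ c + d + x
      add {x} p q = ≤-trans q (≤-trans (+-monoʳ-≤ d p)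
        (≤-reflexive (trans (sym (+-assoc d c x)) (cong (_+ x) (+-comm d c)))))

    within-mono : ∀ {c d σ σ′} → c ≤ d → Within c σ σ′ → Within d σ σ′
    within-mono c≤d (within w₀ w₁ s ch) =
      within w₀ w₁ (≤-trans s (+-monoˡ-≤ _ c≤d)) (≤-trans ch (+-monoˡ-≤ _ c≤d))

    within-tick : ∀ t {σ} → Within t σ (tick t σ)
    within-tick t = within id id ≤-refl (m≤n+m _ t)

    within-op : ∀ t op {σ σ′} → charge k op ≤ t →
                hashOps σ′ ≡ hashOps σ List.++ op ∷ [] → words σ′ 0 ≡ words σ 0 → words σ′ 1 ≡ words σ 1 →
                steps σ′ ≤ t + steps σ → Within t σ σ′
    within-op t op {σ} {σ′} op≤ h w₀ w₁ s = within (trans w₀) (trans w₁) s (begin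
      ∑ (charge k) (hashOps σ′)                          ≡⟨ cong (∑ (charge k)) h ⟩
      ∑ (charge k) (hashOps σ ++ op ∷ [])                ≡⟨ ∑-++ (charge k) (hashOps σ) (op ∷ []) ⟩
      charges σ + (charge k op + 0)                      ≡⟨ trans (cong (charges σ +_) (+-identityʳ _)) (+-comm (charges σ) _) ⟩
      charge k op + charges σ                            ≤⟨ +-monoˡ-≤ _ op≤ ⟩
      t + charges σ                                      ∎)
      where open ≤-Reasoning

    lowerBound≤ : ∀ σ e → lowerBound e ≤ word σ e
    lowerBound≤ σ (lit c) = ≤-refl
    lowerBound≤ σ (mem e) = z≤n
    lowerBound≤ σ (e ⊕ f) = +-mono-≤ (lowerBound≤ σ e) (lowerBound≤ σ f)
    lowerBound≤ σ (e ⊝ f) = z≤n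

    untouched : ∀ σ e {y} → y < 2 → T (2 ≤ᵇ lowerBound e) → y ≢ word σ e
    untouched σ e y<2 h refl = <⇒≱ y<2 (≤-trans (≤ᵇ⇒≤ 2 (lowerBound e) h) (lowerBound≤ σ e))

    iterations-word : ∀ {σ} e → T (is-just (iterations e)) → words σ 0 ≡ k → words σ 1 ≡ ℓ →
                      word σ e ≡ maybe id 0 (iterations e)
    iterations-word (mem (lit 0)) _ w₀ w₁ = w₀
    iterations-word (mem (lit 1)) _ w₀ w₁ = w₁

    within-iterate : ∀ {c} {f : State → State} →
                     (∀ σ → words σ 0 ≡ k → words σ 1 ≡ ℓ → Within c σ (f σ)) →
                     ∀ n σ → words σ 0 ≡ k → words σ 1 ≡ ℓ → Within (n * c) σ (iterate f σ n)
    within-iterate step zero    σ w₀ w₁ = within id id ≤-refl ≤-refl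
    within-iterate step (suc n) σ w₀ w₁ = within-trans once
      (within-iterate step n _ (Within.word₀ once w₀) (Within.word₁ once w₁))
      where once = step σ w₀ w₁

    exec-within : ∀ p → Bounded p → ∀ σ → words σ 0 ≡ k → words σ 1 ≡ ℓ → Within (bound p) σ (exec p σ)
    exec-within skip _ σ w₀ w₁ = within-tick 1
    exec-within (e ≔ f) h σ w₀ w₁ = within
      (trans (↦-other (words σ) (untouched σ e (s≤s z≤n) h))) (trans (↦-other (words σ) (untouched σ e (s≤s (s≤s z≤n)) h)))
      ≤-refl (m≤n+m _ (1 + wordCost e + wordCost f))
    exec-within (e ≔ʷ v) _ σ w₀ w₁ = within id id ≤-refl (m≤n+m _ (1 + wordCost e + weightCost v))
    exec-within (p ⨾ q) (hp , hq) σ w₀ w₁ = within-trans first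
      (exec-within q hq _ (Within.word₀ first w₀) (Within.word₁ first w₁))
      where first = exec-within p hp σ w₀ w₁
    exec-within (test e ≤ f then p else q) (hp , hq) σ w₀ w₁ with does (word σ e ≤? word σ f)
    ... | true  = within-trans (within-tick (1 + wordCost e + wordCost f))
                    (within-mono (m≤m+n _ _) (exec-within p hp _ w₀ w₁))
    ... | false = within-trans (within-tick (1 + wordCost e + wordCost f))
                    (within-mono (m≤n+m _ _) (exec-within q hq _ w₀ w₁))
    exec-within (test v ≤ʷ w then p else q) (hp , hq) σ w₀ w₁ with does (weight σ v ≼? weight σ w)
    ... | true  = within-trans (within-tick (1 + weightCost v + weightCost w))
                    (within-mono (m≤m+n _ _) (exec-within p hp _ w₀ w₁))
    ... | false = within-trans (within-tick (1 + weightCost v + weightCost w))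
                    (within-mono (m≤n+m _ _) (exec-within q hq _ w₀ w₁))
    exec-within (repeat e times p) (he , hp) σ w₀ w₁ rewrite iterations-word {σ} e he w₀ w₁ =
      within-trans (within-tick (1 + wordCost e)) (within-iterate
        (λ τ w₀ w₁ → within-trans (within-tick 1) (exec-within p hp _ w₀ w₁))
        (maybe id 0 (iterations e)) (tick (1 + wordCost e) σ) w₀ w₁)
    exec-within (sample e) h σ w₀ w₁ with random σ
    ... | []    = within (trans (↦-other (words σ) (untouched σ e (s≤s z≤n) h)))
                    (trans (↦-other (words σ) (untouched σ e (s≤s (s≤s z≤n)) h))) ≤-refl (m≤n+m _ (1 + wordCost e))
    ... | _ ∷ _ = within (trans (↦-other (words σ) (untouched σ e (s≤s z≤n) h)))
                    (trans (↦-other (words σ) (untouched σ e (s≤s (s≤s z≤n)) h))) ≤-refl (m≤n+m _ (1 + wordCost e))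
    exec-within (lookup e f g) h σ w₀ w₁ with Assoc.find _≟_ (word σ e) (table σ)
    ... | just _  = within-op _ (lookup (word σ e)) (s≤s z≤n) refl
          (↦-other (words σ) (untouched σ f (s≤s z≤n) h)) (↦-other (words σ) (untouched σ f (s≤s (s≤s z≤n)) h)) ≤-refl
    ... | nothing = within-op _ (lookup (word σ e)) (s≤s z≤n) refl
          (↦-other (words σ) (untouched σ f (s≤s z≤n) h)) (↦-other (words σ) (untouched σ f (s≤s (s≤s z≤n)) h)) ≤-refl
    exec-within (insert e v) _ σ w₀ w₁ = within-op _ (insert (word σ e) (weight σ v)) (s≤s z≤n) refl refl refl ≤-refl
    exec-within (delete e)   _ σ w₀ w₁ = within-op _ (delete (word σ e)) (s≤s z≤n) refl refl refl ≤-refl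

-- Correctness of the program

module Counters-toℕ (G : OrderedAbelianGroup) where
  open OrderedAbelianGroup G renaming (Carrier to V)
  module N = Assoc _≟_ {V}
  open AssocProperties _≟_ {V}

  decrementℕ : V → List (ℕ × V) → List (ℕ × V)
  decrementℕ c T = filter (λ e → ¬? (proj₂ e ≼? 0#)) (List.map (map₂ (_⊖ c)) T)

  distinct-decrementℕ : ∀ c T → Distinct T → Distinct (decrementℕ c T)
  distinct-decrementℕ c T d = AllPairs.filter⁺ _ (AllPairs.map⁺ d)

  find-decrementℕ : ∀ c i T → N.find i T ≡ nothing → N.find i (decrementℕ c T) ≡ nothing
  find-decrementℕ c = find-filter-map (λ e → ¬? (proj₂ e ≼? 0#)) (_⊖ c)

  module _ {m : ℕ} where
    module F = Assoc (Fin._≟_ {m}) {V}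

    encode : Counters G m → List (ℕ × V)
    encode = List.map (map₁ toℕ)

    private
      does-toℕ : ∀ (i j : Fin m) → does (toℕ i ≟ toℕ j) ≡ does (i Fin.≟ j)
      does-toℕ i j with i Fin.≟ j
      ... | yes refl = dec-true (toℕ i ≟ toℕ i) refl
      ... | no  i≢j  = dec-false (toℕ i ≟ toℕ j) (i≢j ∘ Fin.toℕ-injective)

    find-encode : ∀ i T → N.find (toℕ i) (encode T) ≡ F.find i T
    find-encode i []            = refl
    find-encode i ((j , c) ∷ T) = cong₂ (if_then just c else_) (does-toℕ i j) (find-encode i T)

    set-encode : ∀ i v T → N.set (toℕ i) v (encode T) ≡ encode (F.set i v T)
    set-encode i v []            = refl
    set-encode i v ((j , c) ∷ T) with does (i Fin.≟ j) | does (toℕ i ≟ toℕ j) | does-toℕ i j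
    ... | true  | _ | refl = refl
    ... | false | _ | refl = cong ((toℕ j , c) ∷_) (set-encode i v T)

    decrement-encode : ∀ c T → decrementℕ c (encode T) ≡ encode (decrement G c T)
    decrement-encode c []            = refl
    decrement-encode c ((j , v) ∷ T) with does (v ⊖ c ≼? 0#)
    ... | true  = decrement-encode c T
    ... | false = cong ((toℕ j , v ⊖ c) ∷_) (decrement-encode c T)

module Correctness (G : OrderedAbelianGroup) where
  open OrderedAbelianGroup G renaming (Carrier to V)
  open Machine G
  open State
  open Memory G
  open Order G
  open Counters-toℕ G
  open AssocProperties _≟_ {V}

  Stored : {A : Set} → (ℕ → A) → ℕ → List A → Set
  Stored f b []       = ⊤
  Stored f b (v ∷ vs) = f b ≡ v × Stored f (suc b) vs

  stored-bounded : {A : Set} {f g : ℕ → A} {b : ℕ} (vs : List A) →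
                   (∀ y → b ≤ y → y < b + length vs → g y ≡ f y) → Stored f b vs → Stored g b vs
  stored-bounded         []       g≡f _        = _
  stored-bounded {b = b} (v ∷ vs) g≡f (p , ps) =
    trans (g≡f b ≤-refl (m<m+n b (s≤s z≤n))) p ,
    stored-bounded vs (λ y 1+b≤y y< → g≡f y (<⇒≤ 1+b≤y) (≤-trans y< (≤-reflexive (sym (+-suc b (length vs)))))) ps

  stored-cong : {A : Set} {f g : ℕ → A} {b : ℕ} (vs : List A) → (∀ y → b ≤ y → g y ≡ f y) →
                Stored f b vs → Stored g b vs
  stored-cong vs g≡f = stored-bounded vs (λ y b≤y _ → g≡f y b≤y)

  ↦*-below : {A : Set} (f : ℕ → A) {b y : ℕ} (vs : List A) → y < b → (f [ b ↦* vs ]) y ≡ f y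
  ↦*-below f []       y<b = refl
  ↦*-below f {b} (v ∷ vs) y<b = trans (↦-other (f [ suc b ↦* vs ]) (<⇒≢ y<b)) (↦*-below f vs (m<n⇒m<1+n y<b))

  ↦*-stored : {A : Set} (f : ℕ → A) (b : ℕ) (vs : List A) → Stored (f [ b ↦* vs ]) b vs
  ↦*-stored f b []       = _
  ↦*-stored f b (v ∷ vs) = ↦-same (f [ suc b ↦* vs ]) b ,
    stored-cong vs (λ y b<y → ↦-other (f [ suc b ↦* vs ]) (λ y≡b → <⇒≢ b<y (sym y≡b))) (↦*-stored f (suc b) vs)

  stored-valueAt : ∀ {m k} (f : ℕ → V) b (T : Counters G m) .(k≤ : k ≤ length T) (r : Fin k) →
                   Stored f b (List.map proj₂ (encode T)) → f (b + toℕ r) ≡ Analysis.valueAt G T k≤ r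
  stored-valueAt f b (e ∷ T) k≤ Fin.zero    (p , _)  = trans (cong f (+-identityʳ b)) p
  stored-valueAt f b (e ∷ T) k≤ (Fin.suc r) (_ , ps) =
    trans (cong f (+-suc b (toℕ r))) (stored-valueAt f (suc b) T (s≤s⁻¹ k≤) r ps)

  -- Scalars live below address 10 and arrays from 10 on, so writing a scalar never disturbs an
  -- array.
  ≥10⇒≢ : ∀ x {_ : T (x <ᵇ 10)} {y} → 10 ≤ y → y ≢ x
  ≥10⇒≢ x {x<10} 10≤y refl = <⇒≱ (<ᵇ⇒< x 10 x<10) 10≤y

  body : Program → State → State
  body p τ = exec p (tick 1 τ)

  drawSample-step : ∀ σ {r rs} → random σ ≡ r ∷ rs → let σ′ = body drawSample σ in
    (words σ′ ≡ (words σ [ 6 ↦ r ]) [ 5 ↦ suc (words σ 5) ])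
    × (weights σ′ ≡ weights σ [ 10 + (words σ 0 + words σ 5) ↦ weights σ (10 + r) ])
    × random σ′ ≡ rs × table σ′ ≡ table σ
  drawSample-step σ eq rewrite eq = refl , refl , refl , refl

  -- `weights≡` protects everything below the next free cell: the counters, which later draws still
  -- read, and the samples already stored.
  record Sampled {k} (v : Fin k → V) (rs : List (Fin k)) (j : ℕ) (σ σ′ : State) : Set where
    field
      stored  : Stored (weights σ′) (10 + (k + j)) (List.map v rs)
      weights≡ : ∀ y → y < 10 + (k + j) → weights σ′ y ≡ weights σ y
      words≡  : ∀ y → y ≢ 5 → y ≢ 6 → words σ′ y ≡ words σ y
      table≡  : table σ′ ≡ table σ

  drawSamples : ∀ {k} (v : Fin k → V) rs j σ → words σ 0 ≡ k → words σ 5 ≡ j →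
    random σ ≡ List.map toℕ rs → (∀ r → weights σ (10 + toℕ r) ≡ v r) →
    Sampled v rs j σ (iterate (body drawSample) σ (length rs))
  drawSamples v []       j σ w₀ w₅ rnd vals = record
    { stored = _ ; weights≡ = λ _ _ → refl ; words≡ = λ _ _ _ → refl ; table≡ = refl }
  drawSamples {k} v (r ∷ rs) j σ w₀ w₅ rnd vals = record
    { stored   = trans (IH.weights≡ a (≤-reflexive (sym (cong (10 +_) (+-suc k j))))) at-a
               , subst (λ b → Stored (weights σ″) b (List.map v rs)) (cong (10 +_) (+-suc k j)) IH.stored
    ; weights≡ = λ y y<a → trans (IH.weights≡ y (≤-trans (m<n⇒m<1+n y<a) (≤-reflexive (sym (cong (10 +_) (+-suc k j)))))) (below y y<a)
    ; words≡   = λ y y≢5 y≢6 → trans (IH.words≡ y y≢5 y≢6) (trans (cong (λ f → f y) wd)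
                   (trans (↦-other (words σ [ 6 ↦ toℕ r ]) y≢5) (↦-other (words σ) y≢6)))
    ; table≡   = trans IH.table≡ tb
    }
    where
    a = 10 + (k + j)
    σ₁ = body drawSample σ
    σ″ = iterate (body drawSample) σ₁ (length rs)
    step = drawSample-step σ rnd
    wd = proj₁ step
    tb = proj₂ (proj₂ (proj₂ step))
    wt : weights σ₁ ≡ weights σ [ a ↦ v r ]
    wt = trans (proj₁ (proj₂ step)) (cong₂ (λ x u → weights σ [ 10 + x ↦ u ]) (cong₂ _+_ w₀ w₅) (vals r))
    at-a : weights σ₁ a ≡ v r
    at-a = trans (cong (λ f → f a) wt) (↦-same (weights σ) a)
    below : ∀ y → y < a → weights σ₁ y ≡ weights σ y
    below y y<a = trans (cong (λ f → f y) wt) (↦-other (weights σ) (<⇒≢ y<a))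
    ih = drawSamples v rs (suc j) σ₁
      (trans (cong (λ f → f 0) wd) w₀) (trans (cong (λ f → f 5) wd) (cong suc w₅))
      (proj₁ (proj₂ (proj₂ step)))
      (λ r′ → trans (below (10 + toℕ r′) (+-monoʳ-< 10 (<-≤-trans (Fin.toℕ<n r′) (m≤m+n k j)))) (vals r′))
    module IH = Sampled ih

  indicator : Bool → ℕ
  indicator b = if b then 1 else 0

  record Compared (ys : List V) (σ σ′ : State) : Set where
    field
      weights≡ : weights σ′ ≡ weights σ
      table≡   : table σ′ ≡ table σ
      word₆    : words σ′ 6 ≡ #≼ (weights σ 2) ys + words σ 6
      word₇    : words σ′ 7 ≡ #≽ (weights σ 2) ys + words σ 7
      words≡   : ∀ y → y ≢ 6 → y ≢ 7 → y ≢ 8 → words σ′ y ≡ words σ y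

  compareSample-step : ∀ σ → let σ′ = body compareSample σ
                                 x = weights σ 2
                                 y = weights σ (10 + (words σ 0 + words σ 8)) in
    weights σ′ ≡ weights σ × table σ′ ≡ table σ
    × words σ′ 6 ≡ indicator (does (y ≼? x)) + words σ 6
    × words σ′ 7 ≡ indicator (does (x ≼? y)) + words σ 7
    × words σ′ 8 ≡ suc (words σ 8)
    × (∀ z → z ≢ 6 → z ≢ 7 → z ≢ 8 → words σ′ z ≡ words σ z)
  compareSample-step σ with does (weights σ (10 + (words σ 0 + words σ 8)) ≼? weights σ 2)
  ... | true  with does (weights σ 2 ≼? weights σ (10 + (words σ 0 + words σ 8)))
  ...   | true  = refl , refl , refl , refl , refl ,
          λ z z≢6 z≢7 z≢8 → trans (↦-other ((words σ [ 6 ↦ _ ]) [ 7 ↦ _ ]) z≢8) (trans (↦-other (words σ [ 6 ↦ _ ]) z≢7) (↦-other (words σ) z≢6))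
  ...   | false = refl , refl , refl , refl , refl ,
          λ z z≢6 z≢7 z≢8 → trans (↦-other (words σ [ 6 ↦ _ ]) z≢8) (↦-other (words σ) z≢6)
  compareSample-step σ | false with does (weights σ 2 ≼? weights σ (10 + (words σ 0 + words σ 8)))
  ...   | true  = refl , refl , refl , refl , refl ,
          λ z z≢6 z≢7 z≢8 → trans (↦-other (words σ [ 7 ↦ _ ]) z≢8) (↦-other (words σ) z≢7)
  ...   | false = refl , refl , refl , refl , refl ,
          λ z z≢6 z≢7 z≢8 → ↦-other (words σ) z≢8

  private
    tally : ∀ {P : V → Set} (P? : Decidable P) y ys {w w₁ w′} → w₁ ≡ indicator (does (P? y)) + w →
            w′ ≡ count P? ys + w₁ → w′ ≡ count P? (y ∷ ys) + w
    tally P? y ys {w} {w₁} {w′} refl eq = begin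
      w′                              ≡⟨ eq ⟩
      count P? ys + (b + w)           ≡⟨ +-assoc (count P? ys) b w ⟨
      (count P? ys + b) + w           ≡⟨ cong (_+ w) (+-comm (count P? ys) b) ⟩
      (b + count P? ys) + w           ≡⟨ cong (_+ w) (count-∷ P? y ys) ⟨
      count P? (y ∷ ys) + w           ∎
      where
      open ≡-Reasoning
      b = indicator (does (P? y))

  compareSamples : ∀ k ys j σ → words σ 0 ≡ k → words σ 8 ≡ j → Stored (weights σ) (10 + (k + j)) ys →
                   Compared ys σ (iterate (body compareSample) σ (length ys))
  compareSamples k []       j σ w₀ w₈ _ = record
    { weights≡ = refl ; table≡ = refl ; word₆ = refl ; word₇ = refl ; words≡ = λ _ _ _ _ → refl }
  compareSamples k (y ∷ ys) j σ w₀ w₈ (at-y , at-ys) with compareSample-step σ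
  ... | wt , tb , six , seven , eight , other = record
    { weights≡ = trans IH.weights≡ wt
    ; table≡   = trans IH.table≡ tb
    ; word₆    = tally (_≼? x) y ys (trans six (cong (λ z → indicator (does (z ≼? x)) + words σ 6) now))
                   (trans IH.word₆ (cong (λ f → #≼ (f 2) ys + words σ₁ 6) wt))
    ; word₇    = tally (x ≼?_) y ys (trans seven (cong (λ z → indicator (does (x ≼? z)) + words σ 7) now))
                   (trans IH.word₇ (cong (λ f → #≽ (f 2) ys + words σ₁ 7) wt))
    ; words≡   = λ z p q r → trans (IH.words≡ z p q r) (other z p q r)
    }
    where
    x = weights σ 2
    σ₁ = body compareSample σ
    now : weights σ (10 + (words σ 0 + words σ 8)) ≡ y
    now = trans (cong₂ (λ a b → weights σ (10 + (a + b))) w₀ w₈) at-y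
    ih = compareSamples k ys (suc j) σ₁ (trans (other 0 (λ ()) (λ ()) (λ ())) w₀)
      (trans eight (cong suc w₈))
      (subst₂ (λ f b → Stored f b ys) (sym wt) (sym (cong (10 +_) (+-suc k j))) at-ys)
    module IH = Compared ih

  exec-repeat : ∀ e p σ n → word σ e ≡ n → exec (repeat e times p) σ ≡ iterate (body p) (tick (1 + wordCost e) σ) n
  exec-repeat e p σ n refl = refl

  -- `accepts` says that a candidate equal to the median is recorded, and `keeps` that no later
  -- candidate replaces it by another value. A stale value in weight 3 is therefore harmless.
  record Tried (c x : V) (σ σ′ : State) : Set where
    field
      table≡   : table σ′ ≡ table σ
      word₅    : words σ′ 5 ≡ suc (words σ 5)
      words≡   : ∀ y → y ≢ 5 → y ≢ 6 → y ≢ 7 → y ≢ 8 → words σ′ y ≡ words σ y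
      weights≡ : ∀ y → y ≢ 2 → y ≢ 3 → weights σ′ y ≡ weights σ y
      accepts  : x ≡ c → weights σ′ 3 ≡ c
      keeps    : weights σ 3 ≡ c → weights σ′ 3 ≡ c

  -- A rejected candidate cannot be the median, since the median passes both tests; an accepted one
  -- equals it by `median-unique`.
  acceptCandidate-step : ∀ {ys c} σ → IsMedian ys c → words σ 1 ≡ length ys →
    words σ 6 ≡ #≼ (weights σ 2) ys → words σ 7 ≡ #≽ (weights σ 2) ys →
    Tried c (weights σ 2) σ (exec acceptCandidate σ)
  acceptCandidate-step {ys} {c} σ med w₁ w₆ w₇
    with words σ 1 ≤ᵇ words σ 6 + words σ 6 in lo
  ... | false = record
    { table≡ = refl ; word₅ = refl ; words≡ = λ y y≢5 _ _ _ → ↦-other (words σ) y≢5 ; weights≡ = λ _ _ _ → refl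
    ; accepts = λ x≡c → contradiction (≤⇒≤ᵇ (subst₂ (λ a b → a ≤ b + b) (sym w₁)
        (trans (cong (λ z → #≼ z ys) (sym x≡c)) (sym w₆)) (IsMedian.lower med))) (subst (¬_ ∘ T) (sym lo) id)
    ; keeps = id }
  ... | true with suc (words σ 1) ≤ᵇ words σ 7 + words σ 7 in up
  ...   | false = record
    { table≡ = refl ; word₅ = refl ; words≡ = λ y y≢5 _ _ _ → ↦-other (words σ) y≢5 ; weights≡ = λ _ _ _ → refl
    ; accepts = λ x≡c → contradiction (≤⇒≤ᵇ (subst₂ (λ a b → suc a ≤ b + b) (sym w₁)
        (trans (cong (λ z → #≽ z ys) (sym x≡c)) (sym w₇)) (IsMedian.upper med))) (subst (¬_ ∘ T) (sym up) id)
    ; keeps = id }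
  ...   | true  = record
    { table≡ = refl ; word₅ = refl ; words≡ = λ y y≢5 _ _ _ → ↦-other (words σ) y≢5
    ; weights≡ = λ _ _ y≢3 → ↦-other (weights σ) y≢3
    ; accepts = id ; keeps = λ _ → x≡c }
    where
    x≡c : weights σ 2 ≡ c
    x≡c = median-unique med
      (subst₂ (λ a b → a ≤ b + b) w₁ w₆ (≤ᵇ⇒≤ (words σ 1) _ (subst T (sym lo) tt)))
      (subst₂ (λ a b → suc a ≤ b + b) w₁ w₇ (≤ᵇ⇒≤ (suc (words σ 1)) _ (subst T (sym up) tt)))

  tryCandidate-step : ∀ k {ys c x} σ → IsMedian ys c → words σ 0 ≡ k → words σ 1 ≡ length ys →
    Stored (weights σ) (10 + (k + 0)) ys → weights σ (10 + (k + words σ 5)) ≡ x →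
    Tried c x σ (body tryCandidate σ)
  tryCandidate-step k {ys} {c} {x} σ med w₀ w₁ st at-x = record
    { table≡   = trans A.table≡ C.table≡
    ; word₅    = trans A.word₅ (cong suc (C.words≡ 5 (λ ()) (λ ()) (λ ())))
    ; words≡   = λ y y≢5 y≢6 y≢7 y≢8 → trans (A.words≡ y y≢5 y≢6 y≢7 y≢8) (trans (C.words≡ y y≢6 y≢7 y≢8)
        (trans (↦-other ((words σ [ 6 ↦ 0 ]) [ 7 ↦ 0 ]) y≢8) (trans (↦-other (words σ [ 6 ↦ 0 ]) y≢7) (↦-other (words σ) y≢6))))
    ; weights≡ = λ y y≢2 y≢3 → trans (A.weights≡ y y≢2 y≢3) (trans (cong (λ f → f y) C.weights≡) (↦-other (weights σ) y≢2))
    ; accepts  = λ x≡c → A.accepts (trans two≡x x≡c)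
    ; keeps    = λ e → A.keeps (trans (cong (λ f → f 3) C.weights≡) e)
    }
    where
    σ₁ = exec loadCandidate (tick 1 σ)
    σ₂ = exec (repeat mem (lit 1) times compareSample) σ₁
    compared = subst (Compared ys (tick 3 σ₁)) (sym (exec-repeat (mem (lit 1)) compareSample σ₁ (length ys) w₁))
      (compareSamples k ys 0 (tick 3 σ₁) w₀ refl
        (stored-cong ys (λ y 10+≤y → ↦-other (weights σ) (≥10⇒≢ 2 (≤-trans (m≤m+n 10 (k + 0)) 10+≤y))) st))
    module C = Compared compared
    two≡x : weights σ₂ 2 ≡ x
    two≡x = trans (cong (λ f → f 2) C.weights≡) (trans (cong (λ z → weights σ (10 + (z + words σ 5))) w₀) at-x)
    accepted = acceptCandidate-step {ys} {c} σ₂ med (trans (C.words≡ 1 (λ ()) (λ ()) (λ ())) w₁)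
      (trans C.word₆ (trans (+-identityʳ _) (cong (λ f → #≼ (f 2) ys) (sym C.weights≡))))
      (trans C.word₇ (trans (+-identityʳ _) (cong (λ f → #≽ (f 2) ys) (sym C.weights≡))))
    module A = Tried accepted

  record Selected (c : V) (σ σ′ : State) : Set where
    field
      table≡   : table σ′ ≡ table σ
      words≡   : ∀ y → y ≢ 5 → y ≢ 6 → y ≢ 7 → y ≢ 8 → words σ′ y ≡ words σ y
      weights≡ : ∀ y → y ≢ 2 → y ≢ 3 → weights σ′ y ≡ weights σ y
      selected : weights σ′ 3 ≡ c

  -- Loop invariant: the median is among the remaining candidates `zs` or already recorded. `ys` is
  -- the whole sample, against which every candidate is compared.
  tryCandidates : ∀ k {ys c} zs j σ → IsMedian ys c → words σ 0 ≡ k → words σ 1 ≡ length ys → words σ 5 ≡ j →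
    Stored (weights σ) (10 + (k + 0)) ys → Stored (weights σ) (10 + (k + j)) zs →
    c ∈ zs ⊎ weights σ 3 ≡ c → Selected c σ (iterate (body tryCandidate) σ (length zs))
  tryCandidates k []       j σ med w₀ w₁ w₅ st _ (inj₂ sel) = record
    { table≡ = refl ; words≡ = λ _ _ _ _ _ → refl ; weights≡ = λ _ _ _ → refl ; selected = sel }
  tryCandidates k {ys} {c} (z ∷ zs) j σ med w₀ w₁ w₅ st (at-z , at-zs) found = record
    { table≡   = trans IH.table≡ S.table≡
    ; words≡   = λ y p q r s → trans (IH.words≡ y p q r s) (S.words≡ y p q r s)
    ; weights≡ = λ y p q → trans (IH.weights≡ y p q) (S.weights≡ y p q)
    ; selected = IH.selected
    }
    where
    σ₁ = body tryCandidate σ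
    first = tryCandidate-step k {ys} {c} {z} σ med w₀ w₁ st (trans (cong (λ i → weights σ (10 + (k + i))) w₅) at-z)
    module S = Tried first
    frame : ∀ {b} y → 10 + b ≤ y → weights σ₁ y ≡ weights σ y
    frame {b} y 10+b≤y = S.weights≡ y (≥10⇒≢ 2 10≤y) (≥10⇒≢ 3 10≤y)
      where 10≤y = ≤-trans (m≤m+n 10 b) 10+b≤y
    found₁ : c ∈ z ∷ zs ⊎ weights σ 3 ≡ c → c ∈ zs ⊎ weights σ₁ 3 ≡ c
    found₁ (inj₁ (here c≡z))  = inj₂ (S.accepts (sym c≡z))
    found₁ (inj₁ (there c∈)) = inj₁ c∈
    found₁ (inj₂ sel)         = inj₂ (S.keeps sel)
    ih = tryCandidates k zs (suc j) σ₁ med (trans (S.words≡ 0 (λ ()) (λ ()) (λ ()) (λ ())) w₀)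
      (trans (S.words≡ 1 (λ ()) (λ ()) (λ ()) (λ ())) w₁) (trans S.word₅ (cong suc w₅))
      (stored-cong ys frame st)
      (stored-cong zs frame (subst (λ b → Stored (weights σ) b zs) (sym (cong (10 +_) (+-suc k j))) at-zs))
      (found₁ found)
    module IH = Selected ih

  decrementℕ-∷ : ∀ c i u L → decrementℕ c ((i , u) ∷ L) ≡
    (if does (u ⊖ c ≼? 0#) then decrementℕ c L else (i , u ⊖ c) ∷ decrementℕ c L)
  decrementℕ-∷ c i u L with does (u ⊖ c ≼? 0#)
  ... | true  = refl
  ... | false = refl

  record Decremented₁ (c : V) (pre : List (ℕ × V)) (i : ℕ) (u : V) (post : List (ℕ × V)) (σ σ′ : State) : Set where
    field
      pre′     : List (ℕ × V)
      table≡   : table σ′ ≡ pre′ ++ post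
      result≡  : pre′ ++ decrementℕ c post ≡ pre ++ decrementℕ c ((i , u) ∷ post)
      fresh    : ∀ {j} → j ≢ i → Fresh j pre → Fresh j pre′
      size     : words σ′ 3 ≡ length (table σ′)
      word₅    : words σ′ 5 ≡ suc (words σ 5)
      words≡   : ∀ y → y ≢ 3 → y ≢ 5 → words σ′ y ≡ words σ y
      weights≡ : ∀ y → y ≢ 4 → weights σ′ y ≡ weights σ y

  decrementNext-step : ∀ {c pre i u post} σ → weights σ 3 ≡ c →
    words σ (10 + words σ 5) ≡ i → weights σ (10 + words σ 5) ≡ u →
    table σ ≡ pre ++ (i , u) ∷ post → Fresh i pre → Fresh i post → words σ 3 ≡ length (table σ) →
    Decremented₁ c pre i u post σ (body decrementNext σ)
  decrementNext-step {c} {pre} {i} {u} {post} σ refl refl refl tb fresh-pre fresh-post size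
    with does (weights σ (10 + words σ 5) ⊖ weights σ 3 ≼? weights σ 3 ⊖ weights σ 3) in eq
  ... | true = record
    { pre′     = pre
    ; table≡   = tb′
    ; result≡  = cong (pre ++_) (sym (trans (decrementℕ-∷ c i u post)
        (cong (λ b → if b then decrementℕ c post else (i , u ⊖ c) ∷ decrementℕ c post)
              (trans (cong (λ z → does (u ⊖ c ≼? z)) (sym (⊖-self c))) eq))))
    ; fresh    = λ _ → id
    ; size     = trans (cong (_∸ 1) (trans size (trans (cong length tb) (trans (length-++ pre) (+-suc (length pre) (length post))))))
                       (sym (trans (cong length tb′) (length-++ pre)))
    ; word₅    = refl
    ; words≡   = λ y y≢3 y≢5 → trans (↦-other (words σ [ 3 ↦ _ ]) y≢5) (↦-other (words σ) y≢3)
    ; weights≡ = λ y y≢4 → ↦-other (weights σ) y≢4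
    }
    where
    tb′ : N.remove i (table σ) ≡ pre ++ post
    tb′ = trans (cong (N.remove i) tb) (remove-middle pre post fresh-pre fresh-post)
  ... | false = record
    { pre′     = pre ++ [ (i , u ⊖ c) ]
    ; table≡   = trans tb′ (sym (++-assoc pre [ (i , u ⊖ c) ] post))
    ; result≡  = trans (++-assoc pre [ (i , u ⊖ c) ] (decrementℕ c post)) (cong (pre ++_) (sym (trans (decrementℕ-∷ c i u post)
        (cong (λ b → if b then decrementℕ c post else (i , u ⊖ c) ∷ decrementℕ c post)
              (trans (cong (λ z → does (u ⊖ c ≼? z)) (sym (⊖-self c))) eq)))))
    ; fresh    = λ j≢i ps → All.++⁺ ps (j≢i ∷ [])
    ; size     = trans size (trans (cong length tb) (trans (length-++ pre) (sym (trans (cong length tb′) (length-++ pre)))))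
    ; word₅    = refl
    ; words≡   = λ y y≢3 y≢5 → ↦-other (words σ) y≢5
    ; weights≡ = λ y y≢4 → ↦-other (weights σ) y≢4
    }
    where
    tb′ : N.set i (u ⊖ c) (table σ) ≡ pre ++ (i , u ⊖ c) ∷ post
    tb′ = trans (cong (N.set i (u ⊖ c)) tb) (set-middle (u ⊖ c) pre post fresh-pre)

  record Decremented (T : List (ℕ × V)) (σ σ′ : State) : Set where
    field
      table≡   : table σ′ ≡ T
      size     : words σ′ 3 ≡ length (table σ′)
      words≡   : ∀ y → y ≢ 3 → y ≢ 5 → words σ′ y ≡ words σ y
      weights≡ : ∀ y → y ≢ 4 → weights σ′ y ≡ weights σ y

  -- Loop invariant: the table is the processed prefix followed by the untouched suffix. Keys and
  -- values are read from the copy made by `enumerate`, so deletions do not shift what is still to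
  -- be visited; distinct keys ensure that each operation hits the current entry only.
  decrementAll : ∀ {c} pre post j σ → weights σ 3 ≡ c → words σ 5 ≡ j →
    Stored (words σ) (10 + j) (List.map proj₁ post) → Stored (weights σ) (10 + j) (List.map proj₂ post) →
    table σ ≡ pre ++ post → All (λ e → Fresh (proj₁ e) pre) post → Distinct post → words σ 3 ≡ length (table σ) →
    Decremented (pre ++ decrementℕ c post) σ (iterate (body decrementNext) σ (length post))
  decrementAll pre [] j σ w w₅ _ _ tb _ _ size = record
    { table≡ = tb ; size = size ; words≡ = λ _ _ _ → refl ; weights≡ = λ _ _ → refl }
  decrementAll {c} pre ((i , u) ∷ post) j σ w w₅ (at-i , keys) (at-u , vals) tb (fresh ∷ freshs) (d ∷ distinct) size = record
    { table≡   = trans IH.table≡ S.result≡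
    ; size     = IH.size
    ; words≡   = λ y p q → trans (IH.words≡ y p q) (S.words≡ y p q)
    ; weights≡ = λ y p → trans (IH.weights≡ y p) (S.weights≡ y p)
    }
    where
    σ₁ = body decrementNext σ
    first = decrementNext-step {c} {pre} {i} {u} {post} σ w
      (trans (cong (λ z → words σ (10 + z)) w₅) at-i) (trans (cong (λ z → weights σ (10 + z)) w₅) at-u) tb fresh d size
    module S = Decremented₁ first
    10≤ : ∀ {y} → 10 + j < y → 10 ≤ y
    10≤ 10+j<y = ≤-trans (m≤m+n 10 j) (<⇒≤ 10+j<y)
    ih = decrementAll S.pre′ post (suc j) σ₁ (trans (S.weights≡ 3 (λ ())) w)
      (trans S.word₅ (cong suc w₅))
      (subst (λ b → Stored (words σ₁) b (List.map proj₁ post)) (sym (+-suc 10 j))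
        (stored-cong (List.map proj₁ post) (λ y lt → S.words≡ y (≥10⇒≢ 3 (10≤ lt)) (≥10⇒≢ 5 (10≤ lt))) keys))
      (subst (λ b → Stored (weights σ₁) b (List.map proj₂ post)) (sym (+-suc 10 j))
        (stored-cong (List.map proj₂ post) (λ y lt → S.weights≡ y (≥10⇒≢ 4 (10≤ lt))) vals))
      S.table≡ (All.zipWith (λ (i≢j , fr) → S.fresh (λ j≡i → i≢j (sym j≡i)) fr) (d , freshs)) distinct S.size
    module IH = Decremented ih

-- Simulation of the algorithm by the program

module Simulation (G : OrderedAbelianGroup) {m k ℓ : ℕ} .{{_ : NonZero ℓ}} where
  open OrderedAbelianGroup G renaming (Carrier to V)
  open Machine G
  open State
  open Order G
  open Memory G
  open Counters-toℕ G
  open AssocProperties _≟_ {V}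
  open Correctness G
  open Analysis G {m}
  open Cost k ℓ

  -- Equality of lists and not merely of sets, because sampled indices designate counters by
  -- position.
  record Represents (T : Counters G m) (σ : State) : Set where
    constructor represents
    field
      table≡   : table σ ≡ encode T
      size     : words σ 3 ≡ length (table σ)
      distinct : Distinct (table σ)

  insertRest-step : ∀ {T i Δ c} σ → words σ 2 ≡ toℕ i → weights σ 0 ≡ Δ → weights σ 3 ≡ c →
    words σ 3 ≡ length (table σ) → table σ ≡ encode (decrement G c T) → Distinct (table σ) →
    N.find (toℕ i) (table σ) ≡ nothing → Represents (afterDecrement T i Δ c) (exec insertRest σ)
  insertRest-step {T} {i} σ w₂ refl refl size tb dist new with does (weights σ 3 ≼? weights σ 0)
  ... | false = represents tb size dist
  ... | true  rewrite w₂ = represents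
    (trans (cong (N.set (toℕ i) (weights σ 0 ⊖ weights σ 3)) tb) (set-encode i _ (decrement G (weights σ 3) T)))
    (trans (cong suc size) (sym (length-set-new (toℕ i) _ (table σ) new)))
    (distinct-set (toℕ i) _ (table σ) dist)

  module Eviction (T : Counters G m) (k≤ : k ≤ length T) (i : Fin m) (Δ : V) (s : Vec (Fin k) ℓ) (σ : State)
    (|T|≤k : length T ≤ k) (w₀ : words σ 0 ≡ k) (w₁ : words σ 1 ≡ ℓ) (w₂ : words σ 2 ≡ toℕ i)
    (Δ₀ : weights σ 0 ≡ Δ) (rnd : random σ ≡ List.map toℕ (toList s))
    (rep : Represents T σ) (new : Assoc.find Fin._≟_ i T ≡ nothing) where

    open Represents rep
    v = valueAt T k≤
    c* = sampleMedian G T k≤ s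
    ys = List.map v (toList s)

    |s| : length (toList s) ≡ ℓ
    |s| = Vec.length-toList s
    |ys| : length ys ≡ ℓ
    |ys| = trans (length-map v (toList s)) |s|
    |table| : length (table σ) ≡ k
    |table| = trans (cong length table≡) (trans (length-map (map₁ toℕ) T) (≤-antisym |T|≤k k≤))

    med : IsMedian ys c*
    med = subst (λ zs → IsMedian zs c*) (Vec.toList-map v s) (median-isMedian (Vec.map v s))

    keys = List.map proj₁ (table σ)
    vals = List.map proj₂ (table σ)

    σ₁ = exec (enumerate (lit 10) (lit 10)) σ
    σ₂ = tick 3 (exec (lit 5 ≔ lit 0) σ₁)
    σ₃ = exec (loop 1 drawSample) σ₁

    word-σ₁ : ∀ y → y < 10 → words σ₁ y ≡ words σ y
    word-σ₁ y = ↦*-below (words σ) keys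
    weight-σ₁ : ∀ y → y < 10 → weights σ₁ y ≡ weights σ y
    weight-σ₁ y = ↦*-below (weights σ) vals

    sampling = subst (Sampled v (toList s) 0 σ₂)
      (sym (exec-repeat (mem (lit 1)) drawSample (exec (lit 5 ≔ lit 0) σ₁) (length (toList s))
        (trans (word-σ₁ 1 (≤ᵇ⇒≤ 2 10 _)) (trans w₁ (sym |s|)))))
      (drawSamples v (toList s) 0 σ₂ (trans (word-σ₁ 0 (≤ᵇ⇒≤ 1 10 _)) w₀) refl rnd
        (λ r → stored-valueAt (weights σ₁) 10 T k≤ r
          (subst (λ t → Stored (weights σ₁) 10 (List.map proj₂ t)) table≡ (↦*-stored (weights σ) 10 vals))))
    module S = Sampled sampling

    word-σ₃ : ∀ y → y ≢ 5 → y ≢ 6 → words σ₃ y ≡ words σ₁ y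
    word-σ₃ y y≢5 y≢6 = trans (S.words≡ y y≢5 y≢6) (↦-other (words σ₁) y≢5)

    σ₄ = tick 3 (exec (lit 5 ≔ lit 0) σ₃)
    σ₅ = exec (loop 1 tryCandidate) σ₃

    w₁-σ₃ : words σ₃ 1 ≡ length ys
    w₁-σ₃ = trans (word-σ₃ 1 (λ ()) (λ ())) (trans (word-σ₁ 1 (≤ᵇ⇒≤ 2 10 _)) (trans w₁ (sym |ys|)))

    selecting = subst (Selected c* σ₄)
      (sym (exec-repeat (mem (lit 1)) tryCandidate (exec (lit 5 ≔ lit 0) σ₃) (length ys) w₁-σ₃))
      (tryCandidates k ys 0 σ₄ med
        (trans (word-σ₃ 0 (λ ()) (λ ())) (trans (word-σ₁ 0 (≤ᵇ⇒≤ 1 10 _)) w₀)) w₁-σ₃ refl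
        -- The sample serves both as the list to compare with and as the list of candidates. The
        -- median is a member of it, so the search starts with its invariant true.
        S.stored S.stored (inj₁ (IsMedian.member med)))
    module M = Selected selecting

    word-σ₅ : ∀ y → y ≢ 5 → y ≢ 6 → y ≢ 7 → y ≢ 8 → words σ₅ y ≡ words σ₁ y
    word-σ₅ y a b c d = trans (M.words≡ y a b c d) (trans (↦-other (words σ₃) a) (word-σ₃ y a b))
    weight-σ₅ : ∀ y → y ≢ 2 → y ≢ 3 → y < 10 + (k + 0) → weights σ₅ y ≡ weights σ₁ y
    weight-σ₅ y a b y< = trans (M.weights≡ y a b) (S.weights≡ y y<)

    σ₆ = tick 3 (exec (lit 5 ≔ lit 0) σ₅)
    σ₇ = exec (loop 0 decrementNext) σ₅

    table-σ₆ : table σ₆ ≡ table σ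
    table-σ₆ = trans M.table≡ S.table≡

    w₀-σ₅ : words σ₅ 0 ≡ length (table σ)
    w₀-σ₅ = trans (word-σ₅ 0 (λ ()) (λ ()) (λ ()) (λ ())) (trans (word-σ₁ 0 (≤ᵇ⇒≤ 1 10 _)) (trans w₀ (sym |table|)))

    decrementing = subst (Decremented (decrementℕ c* (table σ)) σ₆)
      (sym (exec-repeat (mem (lit 0)) decrementNext (exec (lit 5 ≔ lit 0) σ₅) (length (table σ)) w₀-σ₅))
      (decrementAll [] (table σ) 0 σ₆ M.selected refl
        (stored-cong keys (λ y 10≤y → trans (↦-other (words σ₅) (≥10⇒≢ 5 10≤y))
          (word-σ₅ y (≥10⇒≢ 5 10≤y) (≥10⇒≢ 6 10≤y) (≥10⇒≢ 7 10≤y) (≥10⇒≢ 8 10≤y)))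
          (↦*-stored (words σ) 10 keys))
        -- Weights from 10 + k on now hold the sample, so the enumerated values are preserved only
        -- on their own k cells.
        (stored-bounded vals (λ y 10≤y y< → weight-σ₅ y (≥10⇒≢ 2 10≤y) (≥10⇒≢ 3 10≤y)
            (≤-trans y< (≤-reflexive (cong (10 +_) (trans (length-map proj₂ (table σ)) (trans |table| (sym (+-identityʳ k))))))))
          (↦*-stored (weights σ) 10 vals))
        table-σ₆ (All.universal (λ _ → []) (table σ)) distinct
        (trans (word-σ₅ 3 (λ ()) (λ ()) (λ ()) (λ ())) (trans (word-σ₁ 3 (≤ᵇ⇒≤ 4 10 _)) (trans size (sym (cong length table-σ₆))))))
    module D = Decremented decrementing

    table-σ₇ : table σ₇ ≡ encode (decrement G c* T)
    table-σ₇ = trans D.table≡ (trans (cong (decrementℕ c*) table≡) (decrement-encode c* T))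

    correct : Represents (afterDecrement T i Δ c*) (exec evict σ₁)
    correct = insertRest-step {T} {i} {Δ} {c*} σ₇
      (trans (D.words≡ 2 (λ ()) (λ ())) (trans (word-σ₅ 2 (λ ()) (λ ()) (λ ()) (λ ())) (trans (word-σ₁ 2 (≤ᵇ⇒≤ 3 10 _)) w₂)))
      (trans (D.weights≡ 0 (λ ())) (trans (weight-σ₅ 0 (λ ()) (λ ()) (s≤s z≤n)) (trans (weight-σ₁ 0 (≤ᵇ⇒≤ 1 10 _)) Δ₀)))
      (trans (D.weights≡ 3 (λ ())) M.selected)
      D.size table-σ₇
      (subst Distinct (sym D.table≡) (distinct-decrementℕ c* (table σ) distinct))
      (trans (cong (N.find (toℕ i)) D.table≡) (find-decrementℕ c* (toℕ i) (table σ)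
        (trans (cong (N.find (toℕ i)) table≡) (trans (find-encode i T) new))))

  -- σ′ is left abstract so that type checking does not unfold the rest of
  -- the execution.
  test-true : (P : State → Set) → ∀ e f p q σ → (word σ e ≤ᵇ word σ f) ≡ true →
              (∀ σ′ → σ′ ≡ tick (1 + wordCost e + wordCost f) σ → P (exec p σ′)) → P (exec (test e ≤ f then p else q) σ)
  test-true P e f p q σ eq h =
    subst (λ b → P (if b then exec p σ′ else exec q σ′)) (sym eq) (h σ′ refl)
    where σ′ = tick (1 + wordCost e + wordCost f) σ

  test-false : (P : State → Set) → ∀ e f p q σ → (word σ e ≤ᵇ word σ f) ≡ false →
               (∀ σ′ → σ′ ≡ tick (1 + wordCost e + wordCost f) σ → P (exec q σ′)) → P (exec (test e ≤ f then p else q) σ)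
  test-false P e f p q σ eq h =
    subst (λ b → P (if b then exec p σ′ else exec q σ′)) (sym eq) (h σ′ refl)
    where σ′ = tick (1 + wordCost e + wordCost f) σ

  afterFind : State → Maybe V → State
  afterFind σ r = log (lookup (words σ 2)) (tick 5 (setFound 4 1 r σ))

  find-elim : (P : State → Set) → ∀ q σ r → N.find (words σ 2) (table σ) ≡ r →
              (∀ σ′ → σ′ ≡ afterFind σ r → P (exec q σ′)) → P (exec (findItem ⨾ q) σ)
  find-elim P q σ r refl h = h (afterFind σ r) refl

  -- Three steps, and a charge of k: the table never outgrows k, so the maximum in `charge` is k.
  within-enumerate : ∀ σ → length (table σ) ≤ k → Within G (3 + k) σ (exec (enumerate (lit 10) (lit 10)) σ)
  within-enumerate σ |table|≤k = within-op G (3 + k) (enumerate (length (table σ)))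
    (≤-trans (⊔-lub ≤-refl |table|≤k) (m≤n+m k 3)) refl
    (↦*-below (words σ) (List.map proj₁ (table σ)) (s≤s z≤n)) (↦*-below (words σ) (List.map proj₁ (table σ)) (s≤s (s≤s z≤n)))
    (+-monoˡ-≤ (steps σ) (m≤m+n 3 k))

  evict-step : ∀ T (k≤ : k ≤ length T) i Δ s σ → length T ≤ k → words σ 0 ≡ k → words σ 1 ≡ ℓ → words σ 2 ≡ toℕ i →
    weights σ 0 ≡ Δ → random σ ≡ List.map toℕ (toList s) → Represents T σ → Assoc.find Fin._≟_ i T ≡ nothing →
    let σ′ = exec replace σ in
    Represents (afterDecrement T i Δ (sampleMedian G T k≤ s)) σ′ × Within G callCost σ σ′
  evict-step T k≤ i Δ s σ |T|≤k w₀ w₁ w₂ Δ₀ rnd rep new =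
    Eviction.correct T k≤ i Δ s σ |T|≤k w₀ w₁ w₂ Δ₀ rnd rep new ,
    within-trans G enum (exec-within G evict _ _ (Within.word₀ enum w₀) (Within.word₁ enum w₁))
    where
    enum = within-enumerate σ (≤-trans (≤-reflexive (trans (cong length (Represents.table≡ rep)) (length-map (map₁ toℕ) T))) |T|≤k)

  addNew-step : ∀ T i Δ σ → words σ 0 ≡ k → words σ 1 ≡ ℓ → words σ 2 ≡ toℕ i → weights σ 0 ≡ Δ →
    Represents T σ → Assoc.find Fin._≟_ i T ≡ nothing →
    Represents (Assoc.set Fin._≟_ i Δ T) (exec addNew σ) × Within G (bound addNew) σ (exec addNew σ)
  addNew-step T i Δ σ w₀ w₁ w₂ refl (represents tb size dist) new =
    represents (trans (cong₂ (λ j t → N.set j Δ t) w₂ tb) (set-encode i Δ T))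
      (trans (cong suc size) (sym (length-set-new (words σ 2) Δ (table σ)
        (trans (cong₂ N.find w₂ tb) (trans (find-encode i T) new)))))
      (distinct-set (words σ 2) Δ (table σ) dist) ,
    exec-within G addNew _ σ w₀ w₁

  addOld-step : ∀ T i Δ c σ → words σ 0 ≡ k → words σ 1 ≡ ℓ → words σ 2 ≡ toℕ i → weights σ 0 ≡ Δ → weights σ 1 ≡ c →
    Represents T σ → Assoc.find Fin._≟_ i T ≡ just c →
    Represents (Assoc.set Fin._≟_ i (c ⊹ Δ) T) (exec addOld σ) × Within G (bound addOld) σ (exec addOld σ)
  addOld-step T i Δ c σ w₀ w₁ w₂ refl refl (represents tb size dist) old =
    represents (trans (cong₂ (λ j t → N.set j (c ⊹ Δ) t) w₂ tb) (set-encode i (c ⊹ Δ) T))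
      (trans size (sym (AssocProperties.length-set-found _≟_ (words σ 2) (c ⊹ Δ) (table σ)
        (trans (cong₂ N.find w₂ tb) (trans (find-encode i T) old)))))
      (distinct-set (words σ 2) (c ⊹ Δ) (table σ) dist) ,
    exec-within G addOld _ σ w₀ w₁

  private
    baseCost-old : ∀ a t u x y d → a + (t + x) ≤ (a + (t + (u + (x + y)))) + d
    baseCost-old a t u x y d = ≤-trans (+-monoʳ-≤ a (+-monoʳ-≤ t (≤-trans (m≤m+n x y) (m≤n+m _ u)))) (m≤m+n _ d)

    baseCost-new : ∀ a t u x y d → a + (t + (u + y)) ≤ (a + (t + (u + (x + y)))) + d
    baseCost-new a t u x y d = ≤-trans (+-monoʳ-≤ a (+-monoʳ-≤ t (+-monoʳ-≤ u (m≤n+m y x)))) (m≤m+n _ d)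

    baseCost-call : ∀ a t u x c → a + (t + (u + c)) ≤ (a + (t + (u + x))) + (c + 0)
    baseCost-call a t u x c = ≤-trans (m≤m+n _ x) (≤-reflexive (eq a t u x c))
      where
      eq : ∀ a t u x c → a + (t + (u + c)) + x ≡ (a + (t + (u + x))) + (c + 0)
      eq = solve-∀

  module _ (b : ℕ) .{{_ : NonZero b}} where

    update-step : ∀ {T i Δ s T′ d f} → View b {k} {ℓ} T i Δ s T′ d f → length T ≤ k → ∀ σ → Represents T σ →
      let σ₀ = receive updateProgram ((i , Δ) , s) σ
          σ′ = exec updateProgram σ₀ in
      Represents T′ σ′ × Within G (baseCost + d * callCost) σ₀ σ′
    update-step {T} {i} {Δ} {s} v |T|≤k σ rep = step v
      where
      open Represents rep
      σ₀ = receive updateProgram ((i , Δ) , s) σ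

      find≡ : N.find (toℕ i) (table σ) ≡ Assoc.find Fin._≟_ i T
      find≡ = trans (cong (N.find (toℕ i)) table≡) (find-encode i T)

      |table| : words σ 3 ≡ length T
      |table| = trans size (trans (cong length table≡) (length-map (map₁ toℕ) T))

      within-find : ∀ r → N.find (toℕ i) (table σ) ≡ r → Within G (bound findItem) σ₀ (afterFind σ₀ r)
      within-find r refl = exec-within G findItem _ σ₀ refl refl

      Goal : Counters G m → ℕ → State → Set
      Goal T′ d σ′ = Represents T′ σ′ × Within G (baseCost + d * callCost) σ₀ σ′

      step : ∀ {T′ d f} → View b T i Δ s T′ d f → Goal T′ d (exec updateProgram σ₀)
      step {T′} (hit {c} eq) =
        find-elim (Goal T′ 0) dispatch σ₀ (just c) (trans find≡ eq) λ σ₁ σ₁≡ →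
        test-true (Goal T′ 0) (lit 1) (mem (lit 4)) addOld addMissing σ₁ (cong (λ (τ : State) → 1 ≤ᵇ words τ 4) σ₁≡) λ σ₂ σ₂≡ →
        let e = trans σ₂≡ (cong (tick testCost₁) σ₁≡)
            (rep′ , w) = addOld-step T i Δ c σ₂ (cong (λ (τ : State) → words τ 0) e) (cong (λ (τ : State) → words τ 1) e)
              (cong (λ (τ : State) → words τ 2) e) (cong (λ (τ : State) → weights τ 0) e) (cong (λ (τ : State) → weights τ 1) e)
              (subst (Represents T) (sym e) (represents table≡ size distinct)) eq
        in rep′ , within-mono G (baseCost-old (bound findItem) testCost₁ testCost₂ (bound addOld) (bound addNew) 0)
            (within-trans G (within-find (just c) (trans find≡ eq)) (within-trans G (within-tick G testCost₁)
              (subst (λ τ → Within G (bound addOld) τ (exec addOld σ₂)) e w)))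
      step {T′} (room eq |T|<k) =
        find-elim (Goal T′ 0) dispatch σ₀ nothing (trans find≡ eq) λ σ₁ σ₁≡ →
        test-false (Goal T′ 0) (lit 1) (mem (lit 4)) addOld addMissing σ₁ (cong (λ (τ : State) → 1 ≤ᵇ words τ 4) σ₁≡) λ σ₂ σ₂≡ →
        test-true (Goal T′ 0) (lit 1 ⊕ mem (lit 3)) (mem (lit 0)) addNew replace σ₂
          (trans (cong (λ (τ : State) → suc (words τ 3) ≤ᵇ words τ 0) (trans σ₂≡ (cong (tick testCost₁) σ₁≡)))
            (dec-true (suc (words σ 3) ≤? k) (subst (_< k) (sym |table|) |T|<k))) λ σ₃ σ₃≡ →
        let e = trans σ₃≡ (cong (tick testCost₂) (trans σ₂≡ (cong (tick testCost₁) σ₁≡)))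
            (rep′ , w) = addNew-step T i Δ σ₃ (cong (λ (τ : State) → words τ 0) e) (cong (λ (τ : State) → words τ 1) e)
              (cong (λ (τ : State) → words τ 2) e) (cong (λ (τ : State) → weights τ 0) e)
              (subst (Represents T) (sym e) (represents table≡ size distinct)) eq
        in rep′ , within-mono G (baseCost-new (bound findItem) testCost₁ testCost₂ (bound addOld) (bound addNew) 0)
            (within-trans G (within-find nothing (trans find≡ eq)) (within-trans G (within-tick G testCost₁)
              (within-trans G (within-tick G testCost₂) (subst (λ τ → Within G (bound addNew) τ (exec addNew σ₃)) e w))))
      step {T′} (full eq k≤) =
        find-elim (Goal T′ 1) dispatch σ₀ nothing (trans find≡ eq) λ σ₁ σ₁≡ →
        test-false (Goal T′ 1) (lit 1) (mem (lit 4)) addOld addMissing σ₁ (cong (λ (τ : State) → 1 ≤ᵇ words τ 4) σ₁≡) λ σ₂ σ₂≡ →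
        test-false (Goal T′ 1) (lit 1 ⊕ mem (lit 3)) (mem (lit 0)) addNew replace σ₂
          (trans (cong (λ (τ : State) → suc (words τ 3) ≤ᵇ words τ 0) (trans σ₂≡ (cong (tick testCost₁) σ₁≡)))
            (dec-false (suc (words σ 3) ≤? k) (λ lt → <⇒≱ lt (subst (k ≤_) (sym |table|) k≤)))) λ σ₃ σ₃≡ →
        let e = trans σ₃≡ (cong (tick testCost₂) (trans σ₂≡ (cong (tick testCost₁) σ₁≡)))
            (rep′ , w) = evict-step T k≤ i Δ s σ₃ |T|≤k (cong (λ (τ : State) → words τ 0) e) (cong (λ (τ : State) → words τ 1) e)
              (cong (λ (τ : State) → words τ 2) e) (cong (λ (τ : State) → weights τ 0) e) (cong random e)
              (subst (Represents T) (sym e) (represents table≡ size distinct)) eq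
        in rep′ , within-mono G (baseCost-call (bound findItem) testCost₁ testCost₂ (bound addOld + bound addNew) callCost)
            (within-trans G (within-find nothing (trans find≡ eq)) (within-trans G (within-tick G testCost₁)
              (within-trans G (within-tick G testCost₂)
                (subst (λ τ → Within G callCost τ (exec replace σ₃)) e w))))

    final : ∀ {n} → Stream G m n → Tape k ℓ n → State → State
    final xs ω σ = List.foldl (λ σ u → exec updateProgram (receive updateProgram u σ)) σ (toList (Vec.zip xs ω))

    run-step : ∀ {n} T (xs : Stream G m n) (ω : Tape k ℓ n) → length T ≤ k → ∀ σ → Represents T σ →
      let D = totalCalls b T xs ω in
      Represents (List.foldl (update G) T (toList (Vec.zip xs ω))) (final xs ω σ)
      × steps (final xs ω σ) ≤ (n * baseCost + D * callCost) + steps σ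
      × charges G (final xs ω σ) ≤ (n * baseCost + D * callCost) + charges G σ
    run-step T []             []      _    σ rep = rep , ≤-refl , ≤-refl
    run-step {suc n} T ((i , Δ) ∷ xs) (s ∷ ω) |T|≤k σ rep =
      proj₁ tail , add (Within.steps≤ (proj₂ head)) (proj₁ (proj₂ tail)) , add (Within.charges≤ (proj₂ head)) (proj₂ (proj₂ tail))
      where
      T₁ = update G T ((i , Δ) , s)
      σ₁ = exec updateProgram (receive updateProgram ((i , Δ) , s) σ)
      head : Represents T₁ σ₁ × Within G (baseCost + calls b {k} {ℓ} T i * callCost) (receive updateProgram ((i , Δ) , s) σ) σ₁
      head = update-step (view b T i Δ s) |T|≤k σ rep
      tail = run-step T₁ xs ω (length≤k b (view b T i Δ s) |T|≤k) σ₁ (proj₁ head)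
      d = calls b {k} {ℓ} T i
      D = totalCalls b (update G T ((i , Δ) , s)) xs ω
      regroup : ∀ n d D b c x → (n * b + D * c) + ((b + d * c) + x) ≡ (suc n * b + (d + D) * c) + x
      regroup = solve-∀
      add : ∀ {x y z} → y ≤ (baseCost + d * callCost) + x → z ≤ (n * baseCost + D * callCost) + y →
            z ≤ (suc n * baseCost + (d + D) * callCost) + x
      add {x} p q = ≤-trans q (≤-trans (+-monoʳ-≤ (n * baseCost + D * callCost) p)
        (≤-reflexive (regroup n d D baseCost callCost x)))

-- The theorem

open import Data.Integer.Base using (+_)
open import Data.Rational.Unnormalised.Base using (1ℚᵘ; _/_; _-_; *≤*) renaming (_≤_ to _≤ᵘ_)

-- The bad fraction b/o is at most 1/n, so the good fraction g/o is at least the complement.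
-- Clearing denominators leaves `nat`, where adding (n + 1)b to both sides turns g + b into o.
1-1/n≤ : ∀ g b o n .{{_ : NonZero n}} .{{_ : NonZero o}} → g + b ≡ o → n * b ≤ o →
         1ℚᵘ - (+ 1 / n) ≤ᵘ (+ g / o)
1-1/n≤ g b (suc o) (suc n) g+b≡o nb≤o = *≤* (begin
  (+ 1 ℤ.* + suc n ℤ.+ ℤ.- (+ 1) ℤ.* + 1) ℤ.* + suc o
    ≡⟨ cong (ℤ._* + suc o) (cong (ℤ._+ ℤ.- (+ 1)) (ℤ.*-identityˡ (+ suc n))) ⟩
  + n ℤ.* + suc o ≡⟨ ℤ.pos-* n (suc o) ⟨
  + (n * suc o)  ≤⟨ ℤ.+≤+ nat ⟩
  + (g * suc n)  ≡⟨ ℤ.pos-* g (suc n) ⟩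
  + g ℤ.* + suc n ≡⟨ cong (λ z → + g ℤ.* + z) (+-identityʳ (suc n)) ⟨
  + g ℤ.* + (1 * suc n) ∎)
  where
  open ℤ.≤-Reasoning
  nat : n * suc o ≤ g * suc n
  nat = +-cancelʳ-≤ (suc n * b) _ _ (≤-trans (+-monoʳ-≤ (n * suc o) nb≤o)
    (≤-reflexive (trans (trans (+-comm (n * suc o) (suc o)) (cong (suc n *_) (sym g+b≡o))) (eq n g b))))
    where
    eq : ∀ n g b → suc n * (g + b) ≡ g * suc n + suc n * b
    eq = solve-∀

updateProgram-implements : Implements updateProgram
updateProgram-implements G m k ℓ n xs _ ω = Represents.table≡
  -- The base 1 is an arbitrary choice: the table does not depend on the weights used in the
  -- analysis.
  (proj₁ (run-step 1 [] xs ω z≤n (Machine.initial G) (represents refl refl [])))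
  where open Simulation G {m} {k} {ℓ}

module _ (b : ℕ) .{{_ : NonZero b}} (G : OrderedAbelianGroup) {m k ℓ n : ℕ} .{{_ : NonZero k}} .{{_ : NonZero ℓ}}
         (xs : Stream G m n) (ω : Tape k ℓ n) (c K : ℕ) (K≤ : k ≤ n → K * (k + ℓ * ℓ) ≤ c * n) where
  open Simulation G {m} {k} {ℓ}
  open Analysis G {m}
  open Cost k ℓ
  open Machine G
  open State

  private
    D = totalCalls b {k} {ℓ} [] xs ω
    σ = run updateProgram xs ω

  calls-cost≤ : D ≤ K → D * callCost ≤ callCoefficient * c * n
  calls-cost≤ D≤K with k ≤? n
  ... | no k≰n = ≤-trans (≤-reflexive (cong (_* callCost)
        (no-calls b [] xs ω (subst (_< k) (sym (+-identityʳ n)) (≰⇒> k≰n))))) z≤n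
  ... | yes k≤n = begin
    D * callCost                              ≤⟨ *-mono-≤ D≤K callCost≤ ⟩
    K * (callCoefficient * (k + ℓ * ℓ))       ≡⟨ eq K callCoefficient (k + ℓ * ℓ) ⟩
    callCoefficient * (K * (k + ℓ * ℓ))       ≤⟨ *-monoʳ-≤ callCoefficient (K≤ k≤n) ⟩
    callCoefficient * (c * n)                 ≡⟨ *-assoc callCoefficient c n ⟨
    callCoefficient * c * n                   ∎
    where
    open ≤-Reasoning
    eq : ∀ x y z → x * (y * z) ≡ y * (x * z)
    eq = solve-∀

  -- Steps and hash charges obey the same bound; the former count once and the latter a times,
  -- whence `suc a`.
  time≤ : ∀ {c₀ c₁} → baseCost ≤ c₀ → callCoefficient ≤ c₁ → ∀ a cost → Amortized a k cost → D ≤ K →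
          time updateProgram cost xs ω ≤ suc a * (c₀ + c₁ * c) * n
  time≤ {c₀} {c₁} ≤c₀ ≤c₁ a cost amortized D≤K = begin
    steps σ + cost (hashOps σ)   ≤⟨ +-mono-≤ (bounded (proj₁ (proj₂ ran))) (≤-trans (amortized (hashOps σ)) (*-monoʳ-≤ a (bounded (proj₂ (proj₂ ran))))) ⟩
    suc a * (c₀ * n + c₁ * c * n)   ≡⟨ cong (suc a *_) (*-distribʳ-+ n c₀ (c₁ * c)) ⟨
    suc a * ((c₀ + c₁ * c) * n)     ≡⟨ *-assoc (suc a) (c₀ + c₁ * c) n ⟨
    suc a * (c₀ + c₁ * c) * n       ∎
    where
    open ≤-Reasoning
    ran = run-step b [] xs ω z≤n initial (represents refl refl [])
    bounded : ∀ {x} → x ≤ (n * baseCost + D * callCost) + 0 → x ≤ c₀ * n + c₁ * c * n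
    bounded x≤ = ≤-trans x≤ (≤-trans (≤-reflexive (+-identityʳ _))
      (+-mono-≤ (≤-trans (≤-reflexive (*-comm n baseCost)) (*-monoˡ-≤ n ≤c₀))
                (≤-trans (calls-cost≤ D≤K) (*-monoˡ-≤ n (*-monoˡ-≤ c ≤c₁)))))

private
  q³≡8^ : ∀ ℓ → 2 ^ ℓ * 2 ^ ℓ * 2 ^ ℓ ≡ 8 ^ ℓ
  q³≡8^ ℓ = sym (trans (^-distribʳ-* ℓ 4 2) (cong (_* 2 ^ ℓ) (^-distribʳ-* ℓ 2 2)))

Pr≥1-1/n : ∀ {k ℓ n} .{{_ : NonZero k}} .{{_ : NonZero n}} {P : Tape k ℓ n → Set} (P? : Decidable P) →
           n * length (filter (¬? ∘ P?) (tapes k ℓ n)) ≤ length (tapes k ℓ n) → 1ℚᵘ - (+ 1 / n) ≤ᵘ Pr P?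
Pr≥1-1/n {k} {ℓ} {n} P? = 1-1/n≤ (length (filter P? Ω)) (length (filter (¬? ∘ P?) Ω)) (length Ω) n
  {{_}} {{tapes-nonZero k ℓ n}} (length-filter-¬ P? Ω)
  where Ω = tapes k ℓ n

module _ (b c₀ c₁ : ℕ) .{{_ : NonZero b}} (8^≤ : ∀ ℓ → 2 ^ ℓ * 2 ^ ℓ * 2 ^ ℓ ≤ b ^ ℓ)
         (≤c₀ : ∀ k ℓ → Cost.baseCost k ℓ ≤ c₀) (≤c₁ : ∀ k ℓ → Cost.callCoefficient k ℓ ≤ c₁) where

  fast-given-budget : ∀ (G : OrderedAbelianGroup) {m k ℓ n} .{{_ : NonZero k}} .{{_ : NonZero ℓ}} .{{_ : NonZero n}}
    (c K E : ℕ) → n ≤ (2 ^ ℓ) ^ E → (∀ g → k * g ≤ b * b * n → E + 3 * g ≤ 2 * K) →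
    (k ≤ n → K * (k + ℓ * ℓ) ≤ c * n) →
    (xs : Stream G m n) (a : ℕ) (cost : List (HashOp (OrderedAbelianGroup.Carrier G)) → ℕ) → Amortized a k cost →
    1ℚᵘ - (+ 1 / n) ≤ᵘ Pr (λ (ω : Tape k ℓ n) → Machine.time G updateProgram cost xs ω ≤? suc a * (c₀ + c₁ * c) * n)
  fast-given-budget G {m} {k} {ℓ} {n} c K E n≤ spare K≤ xs a cost amortized = Pr≥1-1/n fast?
    (≤-trans (*-monoʳ-≤ n (count-mono (¬? ∘ fast?) many? (All.universal slow⇒many (tapes k ℓ n))))
      (few-calls G b (8^≤ ℓ) K E n≤ spare xs))
    where
    calls : Tape k ℓ n → ℕ
    calls ω = Analysis.totalCalls G b {k} {ℓ} [] xs ω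
    Fast : Tape k ℓ n → Set
    Fast ω = Machine.time G updateProgram cost xs ω ≤ suc a * (c₀ + c₁ * c) * n
    fast? : Decidable Fast
    fast? ω = Machine.time G updateProgram cost xs ω ≤? suc a * (c₀ + c₁ * c) * n
    many? : Decidable (λ ω → K < calls ω)
    many? ω = K <? calls ω
    slow⇒many : ∀ ω → ¬ Fast ω → K < calls ω
    slow⇒many ω slow = ≰⇒> λ D≤K → slow (time≤ b G xs ω c K K≤ (≤c₀ k ℓ) (≤c₁ k ℓ) a cost amortized D≤K)

  updateProgram-fast : ∀ a (G : OrderedAbelianGroup) (m k n : ℕ) .{{_ : NonZero k}} .{{_ : NonZero n}}
    (xs : Stream G m n) (cost : List (HashOp (OrderedAbelianGroup.Carrier G)) → ℕ) → Amortized a k cost →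
    1ℚᵘ - (+ 1 / n) ≤ᵘ Pr (λ (ω : Tape k (sampleSize n k) n) →
      Machine.time G updateProgram cost xs ω ≤? suc a * (c₀ + c₁ * budgetFactor (b * b)) * n)
  updateProgram-fast a G m k n xs cost amortized =
    let (K , E , n≤ , spare , K≤) = callBudget (b * b) n k in
    fast-given-budget G (budgetFactor (b * b)) K E n≤ spare K≤ xs a cost amortized
    where
    instance
      ℓ≢0 : NonZero (sampleSize n k)
      ℓ≢0 = sampleSize≢0 n k

theorem7 :
    ∃ λ (ℓ : ℕ → ℕ → ℕ) →
    ∃ λ (p : Program) →
      (∀ n k → NonZero (ℓ n k))
      × (∃ λ (c : ℕ) → ∀ n k → 2 ≤ n → ℓ n k ≤ c * ⌊log₂ n ⌋)
      × Implements p
      × (∀ (a : ℕ) → ∃ λ (C : ℕ) →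
           ∀ (G : OrderedAbelianGroup) (m k n : ℕ) .{{_ : NonZero k}} .{{_ : NonZero n}}
             (xs : Stream G m n) → Weighted G xs →
             (cost : List (HashOp (OrderedAbelianGroup.Carrier G)) → ℕ) → Amortized a k cost →
             1ℚᵘ - (+ 1 / n) ≤ᵘ
               Pr (λ (ω : Tape k (ℓ n k) n) → Machine.time G p cost xs ω ≤? C * n))
theorem7 = sampleSize , updateProgram , sampleSize≢0 , (2 , sampleSize≤) , updateProgram-implements ,
  -- The base 8 is 2³, which makes q³ equal to b^ℓ. The constants are evaluated at k = ℓ = 0, but
  -- have the same value for all k and ℓ, as they count loop-free programs.
  λ a → suc a * (c₀ + c₁ * budgetFactor (8 * 8)) , λ G m k n xs _ →
    updateProgram-fast 8 c₀ c₁ (λ ℓ → ≤-reflexive (q³≡8^ ℓ)) (λ _ _ → ≤-refl) (λ _ _ → ≤-refl) a G m k n xs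
  where
  c₀ = Cost.baseCost 0 0
  c₁ = Cost.callCoefficient 0 0
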